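{- Let $n\in\mathbb{N}$, $\varkappa=(\varkappa_1,\ldots,\varkappa_n)\in\mathbb{N}^n$, $N\coloneqq|\varkappa|=\varkappa_1+\cdots+\varkappa_n$, $\lambda$ an integer partition of length $\le N$, and $y_1,\ldots,y_n$ be some variables or pairwise different numbers. Then \[ s_\lambda(y^{[\varkappa]}) =\frac{\det G_\lambda(y,\varkappa)}{\det G_{\emptyset}(y,\varkappa)}. \]
   Context: Here $s_\lambda(x_1,\ldots,x_N)$ denotes the Schur polynomial in $N$ variables associated to $\lambda$, and $y^{[\varkappa]}$ denotes the list of length $N$ in which $y_1$ is repeated $\varkappa_1$ times, then $y_2$ is repeated $\varkappa_2$ times, and so on up to $y_n$ repeated $\varkappa_n$ times. For each $p\in\{1,\ldots,N\}$, let $(q,r)$ be the unique pair with $q\in\{1,\ldots,n\}$, $r\in\{1,\ldots,\varkappa_q\}$ and $p=\varkappa_1+\cdots+\varkappa_{q-1}+r$. The matrix $G_\lambda(y,\varkappa)$ is the $N\times N$ matrix whose $(j,p)$ entry ($j,p\in\{1,\ldots,N\}$, with $(q,r)$ associated to $p$ as just described) is \[ G_\lambda(y,\varkappa)_{j,p}=\begin{cases}\binom{N+\lambda_j-j}{r-1}\,y_q^{\,N+\lambda_j-j-r+1}, & \text{if } N+\lambda_j-j-r+1\ge 0,\\ 0,&\text{otherwise},\end{cases} \] with the convention $\lambda_j=0$ for $j$ greater than the length of $\lambda$. In particular $G_\emptyset(y,\varkappa)$ (the case $\lambda=\emptyset$) is the confluent Vandermonde matrix. -}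

module Defs where

open import Level using (Level)
open import Data.Nat as ℕ using (ℕ; zero; suc; _∸_)
open import Data.Nat.Combinatorics using (_C_)
open import Data.Fin as Fin using (Fin; zero; suc; toℕ)
open import Data.Fin.Properties using (all?)
open import Data.Fin.Properties as FinP using (_≟_)
import Data.Sum
open import Data.Product using (_×_; _,_; proj₁; proj₂)
open import Data.List as List using (List; []; _∷_)
open import Data.Vec as Vec using (Vec)
open import Relation.Nullary using (Dec; yes; no)
open import Relation.Nullary.Decidable using (_×-dec_; _→-dec_)
open import Relation.Binary.PropositionalEquality using (_≡_)
open import Algebra.Bundles using (CommutativeRing)
import Data.Nat.Properties as ℕP

consF : ∀ {a} {A : Set a} {k : ℕ} → A → (Fin k → A) → Fin (suc k) → A
consF a f zero    = a
consF a f (suc i) = f i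

allFuns : (N k : ℕ) → List (Fin k → Fin N)
allFuns N zero    = (λ ()) ∷ []
allFuns N (suc k) =
  List.concatMap (λ a → List.map (consF a) (allFuns N k)) (List.allFin N)

consRow : ∀ {N m} {sh : Fin (suc m) → ℕ} →
          (Fin (sh zero) → Fin N) →
          ((i : Fin m) → Fin (sh (suc i)) → Fin N) →
          (i : Fin (suc m)) → Fin (sh i) → Fin N
consRow r rs zero    = r
consRow r rs (suc i) = rs i

allFillings : (N m : ℕ) (sh : Fin m → ℕ) →
              List ((i : Fin m) → Fin (sh i) → Fin N)
allFillings N zero    sh = (λ ()) ∷ []
allFillings N (suc m) sh =
  List.concatMap
    (λ r → List.map (consRow {sh = sh} r) (allFillings N m (λ i → sh (suc i))))
    (allFuns N (sh zero))

-- Partitions of length ≤ N, padded with zeros to N parts: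
-- λ : Fin N → ℕ weakly decreasing.

IsPartition : (N : ℕ) → (Fin N → ℕ) → Set
IsPartition N lam = ∀ (i j : Fin N) → i Fin.≤ j → lam j ℕ.≤ lam i

-- A filling of the Young diagram of λ (row i has λ i boxes) with
-- entries in {1..N} (encoded as Fin N).
Filling : (N : ℕ) → (Fin N → ℕ) → Set
Filling N lam = (i : Fin N) → Fin (lam i) → Fin N

IsSSYT : (N : ℕ) (lam : Fin N → ℕ) → Filling N lam → Set
IsSSYT N lam T =
  (∀ (i : Fin N) (c c′ : Fin (lam i)) → c Fin.< c′ → T i c Fin.≤ T i c′)
  × (∀ (i i′ : Fin N) (c : Fin (lam i)) (c′ : Fin (lam i′)) →
       i Fin.< i′ → toℕ c ≡ toℕ c′ → T i c Fin.< T i′ c′)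

isSSYT? : (N : ℕ) (lam : Fin N → ℕ) (T : Filling N lam) → Dec (IsSSYT N lam T)
isSSYT? N lam T =
  all? (λ i → all? (λ c → all? (λ c′ → (c Fin.<? c′) →-dec (T i c Fin.≤? T i c′))))
  ×-dec
  all? (λ i → all? (λ i′ → all? (λ c → all? (λ c′ →
     (i Fin.<? i′) →-dec ((toℕ c ℕP.≟ toℕ c′) →-dec (T i c Fin.<? T i′ c′))))))

SSYTs : (N : ℕ) (lam : Fin N → ℕ) → List (Filling N lam)
SSYTs N lam = List.filter (isSSYT? N lam) (allFillings N N lam)

module _ {c ℓ : Level} (R : CommutativeRing c ℓ) where
  open CommutativeRing R using (Carrier; _+_; _*_; -_; 0#; 1#)

  ΣF : {k : ℕ} → (Fin k → Carrier) → Carrier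
  ΣF {zero}  f = 0#
  ΣF {suc k} f = f zero + ΣF (λ i → f (suc i))

  ΠF : {k : ℕ} → (Fin k → Carrier) → Carrier
  ΠF {zero}  f = 1#
  ΠF {suc k} f = f zero * ΠF (λ i → f (suc i))

  ΣL : List Carrier → Carrier
  ΣL = List.foldr _+_ 0#

  pow : Carrier → ℕ → Carrier
  pow x zero    = 1#
  pow x (suc e) = x * pow x e

  fromℕ : ℕ → Carrier
  fromℕ zero    = 0#
  fromℕ (suc n) = 1# + fromℕ n

  sgn : ℕ → Carrier
  sgn zero    = 1#
  sgn (suc k) = - sgn k

  det : {k : ℕ} → (Fin k → Fin k → Carrier) → Carrier
  det {zero}  M = 1#
  det {suc k} M =
    ΣF (λ j → sgn (toℕ j) * (M zero j * det (λ a b → M (suc a) (Fin.punchIn j b))))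

  monomial : {N : ℕ} {lam : Fin N → ℕ} → (Fin N → Carrier) → Filling N lam → Carrier
  monomial {N} {lam} x T = ΠF (λ i → ΠF (λ c → x (T i c)))

  schur : (N : ℕ) (lam : Fin N → ℕ) → (Fin N → Carrier) → Carrier
  schur N lam x = ΣL (List.map (monomial x) (SSYTs N lam))

  -- Multiplicities κ : Vec ℕ n,  N = |κ| = Vec.sum κ.
  -- blockIndex κ p = (q , r−1) where p (1-based) = κ₁+…+κ_{q−1}+r.
  blockIndex : {n : ℕ} (κ : Vec ℕ n) → Fin (Vec.sum κ) → Fin n × ℕ
  blockIndex {suc n} (k Vec.∷ κ) p with Fin.splitAt k p
  ... | Data.Sum.inj₁ r = zero , toℕ r
  ... | Data.Sum.inj₂ p′ = suc (proj₁ (blockIndex κ p′)) , proj₂ (blockIndex κ p′)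

  repeatVars : {n : ℕ} (y : Fin n → Carrier) (κ : Vec ℕ n) → Fin (Vec.sum κ) → Carrier
  repeatVars y κ p = y (proj₁ (blockIndex κ p))

  -- G_λ(y,κ), with 0-based row index j and r = r0 + 1:
  -- exponent N + λ_j − j − r + 1 (1-based j) = a − r0 where a = N + λ_j − j − 1
  -- (0-based j; a ≥ 0 since j ≤ N−1), binomial coefficient (a choose r0).
  Gmat : {n : ℕ} (y : Fin n → Carrier) (κ : Vec ℕ n) (lam : Fin (Vec.sum κ) → ℕ) →
         Fin (Vec.sum κ) → Fin (Vec.sum κ) → Carrier
  Gmat y κ lam j p with blockIndex κ p
  ... | (q , r0) with r0 ℕ.≤? (Vec.sum κ ℕ.+ lam j ∸ suc (toℕ j))
  ...   | yes _ = fromℕ ((Vec.sum κ ℕ.+ lam j ∸ suc (toℕ j)) C r0)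
                  * pow (y q) ((Vec.sum κ ℕ.+ lam j ∸ suc (toℕ j)) ∸ r0)
  ...   | no  _ = 0#

{-# OPTIONS --safe #-}
-- Every column of G_λ, read as a sequence φ in the exponent a, satisfies the linear recurrence
-- ∏ (S − xᵢ) φ = 0, where S is the shift and x = y^[κ]. Newton interpolation at the nodes x, taken
-- in any order, therefore writes φ a = Σₖ V a k · uₖ(φ) with V a k = h_{a−k}(x₀, …, xₖ), so
-- det G_λ = det V_λ · det U with U independent of λ. Subtracting from each row of V_λ a multiple
-- of the next one kills the first column except for its last entry and turns the rest into a sum
-- of V_μ in the remaining variables, over the μ interlacing λ. With the nodes in reverse order
-- this is the recursion of the tableau sum obtained by deleting the largest letter, hence
-- det V_λ = ± s_λ(x) with a sign depending only on N, and s_∅ = 1 gives the identity.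
-- With the nodes in the given order U is triangular, the diagonal entries being products of
-- differences y_q − y_i, so det G_∅ = ± det U does not vanish.
module Submission where

open import Defs
open import Level using (Level; _⊔_)
open import Data.Nat as ℕ using (ℕ; zero; suc; _∸_)
import Data.Nat.Properties as ℕP
open import Data.Nat.Combinatorics using (nCk+nC[k+1]≡[n+1]C[k+1]; nCk≡nC[n∸k]; nCn≡1; k>n⇒nCk≡0) renaming (_C_ to _choose_)
open import Data.Fin as Fin using (Fin; zero; suc; toℕ; inject₁; punchIn; opposite) renaming (fromℕ to lastF)
import Data.Fin.Properties as FinP
import Data.Fin.Induction as FinI
open import Data.Fin.Relation.Unary.Top using (view; ‵fromℕ; ‵inject₁)
open import Data.Vec.Functional using (insertAt)
import Data.Vec.Functional.Properties as VecF
open import Data.List as List using (List; []; _∷_)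
import Data.List.Properties as ListP
open import Data.Vec as Vec using (Vec)
open import Data.Product using (_×_; _,_; proj₁; proj₂; Σ)
open import Data.Sum using (_⊎_; inj₁; inj₂)
open import Data.Unit using (⊤; tt)
open import Function using (_∘_)
open import Relation.Nullary using (¬_; Dec; yes; no; contradiction)
open import Relation.Nullary.Decidable using (_→-dec_)
open import Relation.Binary.PropositionalEquality as ≡ using (_≡_; _≢_)
open import Algebra.Bundles using (CommutativeRing)

-- The two orders of the nodes serve the two halves of the claim. Removing the largest letter of a
-- tableau removes the last variable, whereas `V` is built by stripping the first node, so the two
-- recursions match for the reversed list. In that order the matrix of Newton coefficients is in
-- general not triangular, and nothing shows that its determinant is nonzero. In the given order it
-- is triangular; there it is paired with the empty partition, whose tableau sum is 1 for any choice
-- of variables. Both interpolations are legitimate because the factors S - xᵢ commute, so a single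
-- recurrence serves every order. The largest letter can be removed uniformly because column
-- strictness fixes the last of the N rows: all its entries are that letter. What is left has one
-- row and one variable fewer, just as the determinant loses one row and one column. Since `det` is
-- defined by expansion along row 0, the product rule comes from characterising the determinant as
-- the alternating form with value 1 at the identity.

punchIn-elim : ∀ {a n} (P : Fin (suc n) → Set a) k → P k → (∀ q → P (punchIn k q)) → ∀ p → P p
punchIn-elim P k h hs p with k FinP.≟ p
... | yes ≡.refl = h
... | no k≢p = ≡.subst P (FinP.punchIn-punchOut k≢p) (hs _)

punchIn-last : ∀ {n} (i : Fin n) → punchIn (lastF n) i ≡ inject₁ i
punchIn-last zero    = ≡.refl
punchIn-last (suc i) = ≡.cong suc (punchIn-last i)

snocF : ∀ {a} {A : Set a} {n} → (Fin n → A) → A → Fin (suc n) → A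
snocF {n = zero}  f a i       = a
snocF {n = suc n} f a zero    = f zero
snocF {n = suc n} f a (suc i) = snocF (f ∘ suc) a i

snocF-inject₁ : ∀ {a} {A : Set a} {n} (f : Fin n → A) x i → snocF f x (inject₁ i) ≡ f i
snocF-inject₁ f x zero    = ≡.refl
snocF-inject₁ f x (suc i) = snocF-inject₁ (f ∘ suc) x i

snocF-last : ∀ {a} {A : Set a} {n} (f : Fin n → A) x → snocF f x (lastF n) ≡ x
snocF-last {n = zero}  f x = ≡.refl
snocF-last {n = suc n} f x = snocF-last (f ∘ suc) x

-- The staircase N - 1 - j for 0-based j, so that `l j ℕ.+ co j` is the exponent attached to row j.
co : ∀ {n} → Fin n → ℕ
co {n} j = n ∸ suc (toℕ j)

co-inject₁ : ∀ {n} (j : Fin n) → co (inject₁ j) ≡ suc (co j)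
co-inject₁ {suc n} zero    = ≡.refl
co-inject₁ {suc n} (suc j) = co-inject₁ j

co-last : ∀ n → co (lastF n) ≡ 0
co-last zero    = ≡.refl
co-last (suc n) = co-last n

-- Compares neighbouring parts only, which is the form that row reduction and interlacing work with.
Descending : ∀ {N} → (Fin N → ℕ) → Set
Descending {zero}  l = ⊤
Descending {suc N} l = ∀ i → l (suc i) ℕ.≤ l (inject₁ i)

-- Fillings

Descending⇒IsPartition : ∀ {N} (l : Fin N → ℕ) → Descending l → IsPartition N l
Descending⇒IsPartition l d zero zero h = ℕP.≤-refl
Descending⇒IsPartition {suc (suc N)} l d zero (suc j) h =
  ℕP.≤-trans (Descending⇒IsPartition (l ∘ suc) (λ i → d (suc i)) zero j ℕ.z≤n) (d zero)
Descending⇒IsPartition {suc (suc N)} l d (suc i) (suc j) h =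
  Descending⇒IsPartition (l ∘ suc) (λ i → d (suc i)) i j (ℕP.≤-pred h)

IsPartition⇒Descending : ∀ {N} (l : Fin N → ℕ) → IsPartition N l → Descending l
IsPartition⇒Descending {zero}  l p = tt
IsPartition⇒Descending {suc N} l p i =
  p (inject₁ i) (suc i) (ℕP.≤-trans (ℕP.≤-reflexive (FinP.toℕ-inject₁ i)) (ℕP.n≤1+n _))

-- The lower half of the interlacing condition. The upper half, `μ i ≤ l (inject₁ i)`, comes from
-- the range over which μ is summed.
Interlaces : ∀ {N} → (Fin (suc N) → ℕ) → (Fin N → ℕ) → Set
Interlaces l μ = ∀ a → l (suc a) ℕ.≤ μ a

interlaced-Descending : ∀ {N} (l : Fin (suc N) → ℕ) (μ : Fin N → ℕ) →
                        Interlaces l μ → (∀ i → μ i ℕ.≤ l (inject₁ i)) → Descending μ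
interlaced-Descending {zero}  l μ p q   = tt
interlaced-Descending {suc N} l μ p q i = ℕP.≤-trans (q (suc i)) (p (inject₁ i))

Fill : (N : ℕ) {m : ℕ} → (Fin m → ℕ) → Set
Fill N {m} sh = (i : Fin m) → Fin (sh i) → Fin N

infix 4 _≗₂_
_≗₂_ : ∀ {N m} {sh : Fin m → ℕ} → Fill N sh → Fill N sh → Set
T ≗₂ T′ = ∀ i c → T i c ≡ T′ i c

WeaklyIncreasing : ∀ {N k} → (Fin k → Fin N) → Set
WeaklyIncreasing r = ∀ c c′ → c Fin.< c′ → r c Fin.≤ r c′

weaklyIncreasing? : ∀ {N k} (r : Fin k → Fin N) → Dec (WeaklyIncreasing r)
weaklyIncreasing? r = FinP.all? λ c → FinP.all? λ c′ → (c Fin.<? c′) →-dec (r c Fin.≤? r c′)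

LowerBound : ∀ {N k} → Fin N → (Fin k → Fin N) → Set
LowerBound a r = ∀ c → a Fin.≤ r c

lowerBound? : ∀ {N k} (a : Fin N) (r : Fin k → Fin N) → Dec (LowerBound a r)
lowerBound? a r = FinP.all? λ c → a Fin.≤? r c

WeaklyIncreasing-consF : ∀ {N k} (a : Fin N) (r : Fin k → Fin N) → WeaklyIncreasing (consF a r) →
                         WeaklyIncreasing r × LowerBound a r
WeaklyIncreasing-consF a r w = (λ c c′ h → w (suc c) (suc c′) (ℕ.s≤s h)) , (λ c → w zero (suc c) (ℕ.s≤s ℕ.z≤n))

consF-WeaklyIncreasing : ∀ {N k} (a : Fin N) (r : Fin k → Fin N) → WeaklyIncreasing r × LowerBound a r →
                         WeaklyIncreasing (consF a r)
consF-WeaklyIncreasing a r (w , b) zero    (suc c′) h = b c′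
consF-WeaklyIncreasing a r (w , b) (suc c) (suc c′) h = w c c′ (ℕP.≤-pred h)

RowsIncreasing : ∀ {N m} (sh : Fin m → ℕ) → Fill N sh → Set
RowsIncreasing sh T = ∀ i → WeaklyIncreasing (T i)

rowsIncreasing? : ∀ {N m} (sh : Fin m → ℕ) (T : Fill N sh) → Dec (RowsIncreasing sh T)
rowsIncreasing? sh T = FinP.all? (λ i → weaklyIncreasing? (T i))

ColumnStrict : ∀ {N m} (sh : Fin m → ℕ) → Fill N sh → Set
ColumnStrict sh T = ∀ i i′ (c : Fin (sh i)) (c′ : Fin (sh i′)) →
  i Fin.< i′ → toℕ c ≡ toℕ c′ → T i c Fin.< T i′ c′

columnStrict? : ∀ {N m} (sh : Fin m → ℕ) (T : Fill N sh) → Dec (ColumnStrict sh T)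
columnStrict? sh T = FinP.all? λ i → FinP.all? λ i′ → FinP.all? λ c → FinP.all? λ c′ →
  (i Fin.<? i′) →-dec ((toℕ c ℕP.≟ toℕ c′) →-dec (T i c Fin.<? T i′ c′))

ColumnStrict-resp : ∀ {N m} {sh : Fin m → ℕ} {T T′ : Fill N sh} → T ≗₂ T′ →
                    ColumnStrict sh T → ColumnStrict sh T′
ColumnStrict-resp e cs i i′ c c′ h q = ≡.subst₂ Fin._<_ (e i c) (e i′ c′) (cs i i′ c c′ h q)

-- A weakly increasing row of length l over suc N letters is extend l m r for a unique m ≤ l
-- and a unique weakly increasing row r of length m over N letters.
extend : ∀ {N} (l m : ℕ) → (Fin m → Fin N) → Fin l → Fin (suc N)
extend {N} l   zero    r c       = lastF N
extend (suc l) (suc m) r zero    = inject₁ (r zero)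
extend (suc l) (suc m) r (suc c) = extend l m (r ∘ suc) c

extend-< : ∀ {N} l m (r : Fin m → Fin N) (c : Fin l) (d : Fin m) → toℕ c ≡ toℕ d →
           extend l m r c ≡ inject₁ (r d)
extend-< (suc l) (suc m) r zero    zero    e = ≡.refl
extend-< (suc l) (suc m) r (suc c) (suc d) e = extend-< l m (r ∘ suc) c d (ℕP.suc-injective e)

extend-≥ : ∀ {N} l m (r : Fin m → Fin N) (c : Fin l) → m ℕ.≤ toℕ c → extend l m r c ≡ lastF N
extend-≥ l       zero    r c       h = ≡.refl
extend-≥ (suc l) (suc m) r (suc c) h = extend-≥ l m (r ∘ suc) c (ℕP.≤-pred h)

extendFill : ∀ {N m} (sh μ : Fin m → ℕ) → Fill N μ → Fill (suc N) sh
extendFill sh μ T i = extend (sh i) (μ i) (T i)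

snocRow : ∀ {N m} {sh : Fin (suc m) → ℕ} → Fill N (sh ∘ inject₁) → (Fin (sh (lastF m)) → Fin N) → Fill N sh
snocRow {m = zero}  T r zero    = r
snocRow {m = suc m} T r zero    = T zero
snocRow {m = suc m} {sh} T r (suc i) = snocRow {sh = sh ∘ suc} (λ i → T (suc i)) r i

snocRow-inject₁ : ∀ {N m} {sh : Fin (suc m) → ℕ} (T : Fill N (sh ∘ inject₁)) r i c →
                  snocRow {sh = sh} T r (inject₁ i) c ≡ T i c
snocRow-inject₁ T r zero    c = ≡.refl
snocRow-inject₁ {sh = sh} T r (suc i) c = snocRow-inject₁ {sh = sh ∘ suc} (λ i → T (suc i)) r i c

snocRow-last : ∀ {N m} {sh : Fin (suc m) → ℕ} (T : Fill N (sh ∘ inject₁)) r c →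
               snocRow {sh = sh} T r (lastF m) c ≡ r c
snocRow-last {m = zero}  T r c = ≡.refl
snocRow-last {m = suc m} {sh = sh} T r c = snocRow-last {sh = sh ∘ suc} (λ i → T (suc i)) r c

snocRow-cong : ∀ {N m} {sh : Fin (suc m) → ℕ} {T T′ : Fill N (sh ∘ inject₁)} {r r′} →
               T ≗₂ T′ → (∀ c → r c ≡ r′ c) → snocRow {sh = sh} T r ≗₂ snocRow T′ r′
snocRow-cong {m = zero}  h k zero    = k
snocRow-cong {m = suc m} h k zero    = h zero
snocRow-cong {m = suc m} {sh = sh} h k (suc i) = snocRow-cong {sh = sh ∘ suc} (λ i → h (suc i)) k i

consRow-cong : ∀ {N m} {sh : Fin (suc m) → ℕ} {r r′ : Fin (sh zero) → Fin N} {T T′ : Fill N (sh ∘ suc)} →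
               (∀ c → r c ≡ r′ c) → T ≗₂ T′ → consRow {sh = sh} r T ≗₂ consRow {sh = sh} r′ T′
consRow-cong h k zero    = h
consRow-cong h k (suc i) = k i

-- Parts decrease, so each cell below row 0 has a cell above it, whose entry is smaller by at least
-- one. In the last of N + 1 rows this leaves only the largest letter.
ColumnStrict-bound : ∀ {N m} (l : Fin (suc m) → ℕ) → IsPartition (suc m) l → (T : Fill N l) →
                     ColumnStrict l T → ∀ i c → toℕ i ℕ.≤ toℕ (T i c)
ColumnStrict-bound l part T cs = FinI.<-weakInduction _ (λ _ → ℕ.z≤n) λ i ih c →
  let d≤ = IsPartition⇒Descending l part i
      d  = Fin.inject≤ c d≤
  in ℕP.≤-trans (ℕ.s≤s (≡.subst (ℕ._≤ toℕ (T (inject₁ i) d)) (FinP.toℕ-inject₁ i) (ih d)))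
       (cs (inject₁ i) (suc i) d c (ℕ.s≤s (ℕP.≤-reflexive (FinP.toℕ-inject₁ i))) (FinP.toℕ-inject≤ c d≤))

last-≰ : ∀ {N} (a : Fin N) → ¬ (lastF N Fin.≤ inject₁ a)
last-≰ {N} a h = ℕP.<⇒≱ (FinP.toℕ<n a) (≡.subst₂ ℕ._≤_ (FinP.toℕ-fromℕ N) (FinP.toℕ-inject₁ a) h)

last-max : ∀ {N} (a : Fin (suc N)) → N ℕ.≤ toℕ a → a ≡ lastF N
last-max {N} a h = FinP.toℕ-injective
  (≡.trans (ℕP.≤-antisym (ℕP.≤-pred (FinP.toℕ<n a)) h) (≡.sym (FinP.toℕ-fromℕ N)))

inject₁<last : ∀ {N} (a : Fin N) → inject₁ a Fin.< lastF N
inject₁<last {N} a = ≡.subst₂ ℕ._<_ (≡.sym (FinP.toℕ-inject₁ a)) (≡.sym (FinP.toℕ-fromℕ N)) (FinP.toℕ<n a)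

inject₁-mono-< : ∀ {N} {a b : Fin N} → a Fin.< b → inject₁ a Fin.< inject₁ b
inject₁-mono-< {a = a} {b} = ≡.subst₂ ℕ._<_ (≡.sym (FinP.toℕ-inject₁ a)) (≡.sym (FinP.toℕ-inject₁ b))

inject₁-cancel-< : ∀ {N} {a b : Fin N} → inject₁ a Fin.< inject₁ b → a Fin.< b
inject₁-cancel-< {a = a} {b} = ≡.subst₂ ℕ._<_ (FinP.toℕ-inject₁ a) (FinP.toℕ-inject₁ b)

-- Completing a filling with the largest letter

module _ {N} (l : Fin (suc N) → ℕ) (part : IsPartition (suc N) l)
         (μ : Fin N → ℕ) (μ≤l : ∀ i → μ i ℕ.≤ l (inject₁ i)) (T : Fill N μ) where

  -- The largest letter fills everything outside μ, in particular the whole last row, as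
  -- `ColumnStrict-bound` forces.
  completed : Fill (suc N) l
  completed = snocRow (extendFill (l ∘ inject₁) μ T) (λ _ → lastF N)

  completed-< : ∀ a (C : Fin (l (inject₁ a))) (d : Fin (μ a)) → toℕ C ≡ toℕ d →
                completed (inject₁ a) C ≡ inject₁ (T a d)
  completed-< a C d e = ≡.trans (snocRow-inject₁ {sh = l} _ _ a C) (extend-< _ _ (T a) C d e)

  completed-≥ : ∀ a (C : Fin (l (inject₁ a))) → μ a ℕ.≤ toℕ C → completed (inject₁ a) C ≡ lastF N
  completed-≥ a C h = ≡.trans (snocRow-inject₁ {sh = l} _ _ a C) (extend-≥ _ _ (T a) C h)

  -- If row a + 1 reached past μ a, the cell of row a in column μ a would carry the largest letter,
  -- and the cell below it would need a larger one.
  ColumnStrict⇒Interlaces : ColumnStrict l completed → Interlaces l μ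
  ColumnStrict⇒Interlaces cs a with l (suc a) ℕ.≤? μ a
  ... | yes h = h
  ... | no ¬h = contradiction (≡.subst (Fin._< completed (suc a) C′) (completed-≥ a C (ℕP.≤-reflexive (≡.sym C≡)))
                  (cs (inject₁ a) (suc a) C C′ (ℕ.s≤s (ℕP.≤-reflexive (FinP.toℕ-inject₁ a))) (≡.trans C≡ (≡.sym C′≡))))
                  (ℕP.≤⇒≯ (FinP.≤fromℕ _))
    where
    μ<l : μ a ℕ.< l (suc a)
    μ<l = ℕP.≰⇒> ¬h
    C′ : Fin (l (suc a))
    C′ = Fin.fromℕ< μ<l
    C′≡ : toℕ C′ ≡ μ a
    C′≡ = FinP.toℕ-fromℕ< μ<l
    C : Fin (l (inject₁ a))
    C = Fin.inject≤ C′ (IsPartition⇒Descending l part a)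
    C≡ : toℕ C ≡ μ a
    C≡ = ≡.trans (FinP.toℕ-inject≤ C′ (IsPartition⇒Descending l part a)) C′≡

  ColumnStrict⇒ColumnStrict : ColumnStrict l completed → ColumnStrict μ T
  ColumnStrict⇒ColumnStrict cs i i′ c c′ h e = inject₁-cancel-<
    (≡.subst₂ Fin._<_ (completed-< i C c C≡) (completed-< i′ C′ c′ C′≡)
      (cs (inject₁ i) (inject₁ i′) C C′ (inject₁-mono-< {a = i} {i′} h) (≡.trans C≡ (≡.trans e (≡.sym C′≡)))))
    where
    C : Fin (l (inject₁ i))
    C = Fin.inject≤ c (μ≤l i)
    C≡ : toℕ C ≡ toℕ c
    C≡ = FinP.toℕ-inject≤ c (μ≤l i)
    C′ : Fin (l (inject₁ i′))
    C′ = Fin.inject≤ c′ (μ≤l i′)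
    C′≡ : toℕ C′ ≡ toℕ c′
    C′≡ = FinP.toℕ-inject≤ c′ (μ≤l i′)

  -- A cell of row a with another cell below it in row i′ lies inside μ, since its column index is
  -- less than l i′ ≤ l (a + 1) ≤ μ a. Its letter is therefore an old one, and the lower letter is
  -- either the largest or already compared within T.
  completed-ColumnStrict : Interlaces l μ → ColumnStrict μ T → ColumnStrict l completed
  completed-ColumnStrict inter cs i i′ C C′ h e with view i
  ... | ‵fromℕ = contradiction h (ℕP.≤⇒≯ (FinP.≤fromℕ i′))
  ... | ‵inject₁ a = ≡.subst (Fin._< completed i′ C′) (≡.sym (completed-< a C c c≡)) (case′ i′ C′ h e)
    where
    a<i′⇒ : ∀ {i′ : Fin (suc N)} → inject₁ a Fin.< i′ → suc a Fin.≤ i′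
    a<i′⇒ {i′} = ≡.subst (ℕ._< toℕ i′) (FinP.toℕ-inject₁ a)
    C<μ : toℕ C ℕ.< μ a
    C<μ = ℕP.≤-trans (≡.subst (ℕ._< l i′) (≡.sym e) (FinP.toℕ<n C′))
            (ℕP.≤-trans (part (suc a) i′ (a<i′⇒ h)) (inter a))
    c : Fin (μ a)
    c = Fin.fromℕ< C<μ
    c≡ : toℕ C ≡ toℕ c
    c≡ = ≡.sym (FinP.toℕ-fromℕ< C<μ)
    case′ : ∀ i′ (C′ : Fin (l i′)) → inject₁ a Fin.< i′ → toℕ C ≡ toℕ C′ → inject₁ (T a c) Fin.< completed i′ C′
    case′ i′ C′ h e with view i′
    ... | ‵fromℕ = ≡.subst (inject₁ (T a c) Fin.<_) (≡.sym (snocRow-last {sh = l} _ _ C′)) (inject₁<last (T a c))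
    ... | ‵inject₁ a′ with toℕ C′ ℕ.<? μ a′
    ...   | yes C′<μ = ≡.subst (inject₁ (T a c) Fin.<_)
              (≡.sym (completed-< a′ C′ (Fin.fromℕ< C′<μ) (≡.sym (FinP.toℕ-fromℕ< C′<μ))))
              (inject₁-mono-< {a = T a c} (cs a a′ c _ (inject₁-cancel-< {a = a} {a′} h)
                (≡.trans (≡.sym c≡) (≡.trans e (≡.sym (FinP.toℕ-fromℕ< C′<μ))))))
    ...   | no C′≮μ = ≡.subst (inject₁ (T a c) Fin.<_) (≡.sym (completed-≥ a′ C′ (ℕP.≮⇒≥ C′≮μ))) (inject₁<last (T a c))

LowerBound-extend : ∀ {N} (a : Fin N) l m (r : Fin m → Fin N) → LowerBound a r →
                    LowerBound (inject₁ a) (extend l m r)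
LowerBound-extend a l       zero    r h c       = FinP.≤fromℕ _
LowerBound-extend a (suc l) (suc m) r h zero    =
  ≡.subst₂ ℕ._≤_ (≡.sym (FinP.toℕ-inject₁ a)) (≡.sym (FinP.toℕ-inject₁ (r zero))) (h zero)
LowerBound-extend a (suc l) (suc m) r h (suc c) = LowerBound-extend a l m (r ∘ suc) (h ∘ suc) c

extend-LowerBound : ∀ {N} (a : Fin N) l m (r : Fin m → Fin N) → m ℕ.≤ l →
                    LowerBound (inject₁ a) (extend l m r) → LowerBound a r
extend-LowerBound a (suc l) (suc m) r m≤l h zero =
  ≡.subst₂ ℕ._≤_ (FinP.toℕ-inject₁ a) (FinP.toℕ-inject₁ (r zero)) (h zero)
extend-LowerBound a (suc l) (suc m) r m≤l h (suc c) =
  extend-LowerBound a l m (r ∘ suc) (ℕP.≤-pred m≤l) (h ∘ suc) c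

module _ {c ℓ : Level} (R : CommutativeRing c ℓ) where
  open CommutativeRing R
    using (Carrier; _≈_; _+_; _*_; -_; 0#; 1#; setoid; refl; sym; trans; reflexive;
           +-cong; +-congˡ; +-congʳ; *-cong; *-congˡ; *-congʳ; -‿cong;
           +-identityˡ; +-identityʳ; *-identityˡ; *-identityʳ; zeroˡ; zeroʳ;
           +-assoc; +-comm; *-assoc; *-comm; distribˡ; distribʳ;
           -‿inverseˡ; -‿inverseʳ; ring; commutativeSemiring)
  open import Algebra.Properties.Ring ring
    using (-‿distribˡ-*; -0#≈0#; -‿involutive; x+x≈x⇒x≈0)
  open import Algebra.Solver.Ring.NaturalCoefficients.Default commutativeSemiring
    using (solve; _:+_; _:*_; _:=_)
  open import Relation.Binary.Reasoning.Setoid setoid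

  -- ΣF, ΠF and det unfold at successors, which defeats unification: hence these opaque copies.
  opaque
    ∑ : ∀ {k} → (Fin k → Carrier) → Carrier
    ∑ = ΣF R

    ∏ : ∀ {k} → (Fin k → Carrier) → Carrier
    ∏ = ΠF R

    Det : ∀ {k} → (Fin k → Fin k → Carrier) → Carrier
    Det = det R

    ∑-zero : (f : Fin 0 → Carrier) → ∑ f ≈ 0#
    ∑-zero f = refl

    ∑-suc : ∀ {k} (f : Fin (suc k) → Carrier) → ∑ f ≈ f zero + ∑ (λ i → f (suc i))
    ∑-suc f = refl

    ∏-def : ∀ {k} (f : Fin k → Carrier) → ∏ f ≡ ΠF R f
    ∏-def f = ≡.refl

    ∏-zero : (f : Fin 0 → Carrier) → ∏ f ≈ 1#
    ∏-zero f = refl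

    ∏-suc : ∀ {k} (f : Fin (suc k) → Carrier) → ∏ f ≈ f zero * ∏ (λ i → f (suc i))
    ∏-suc f = refl

    Det-def : ∀ {k} (M : Fin k → Fin k → Carrier) → Det M ≡ det R M
    Det-def M = ≡.refl

    Det-zero : (M : Fin 0 → Fin 0 → Carrier) → Det M ≈ 1#
    Det-zero M = refl

    Det-row0 : ∀ {k} (M : Fin (suc k) → Fin (suc k) → Carrier) →
               Det M ≈ ∑ (λ j → sgn R (toℕ j) * (M zero j * Det (λ a b → M (suc a) (punchIn j b))))
    Det-row0 M = refl

  -- Finite sums and products

  ∑-cong : ∀ {k} {f g : Fin k → Carrier} → (∀ i → f i ≈ g i) → ∑ f ≈ ∑ g
  ∑-cong {zero}  h = trans (∑-zero _) (sym (∑-zero _))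
  ∑-cong {suc k} h = trans (∑-suc _) (trans (+-cong (h zero) (∑-cong (h ∘ suc))) (sym (∑-suc _)))

  ∑-≈0 : ∀ {k} {f : Fin k → Carrier} → (∀ i → f i ≈ 0#) → ∑ f ≈ 0#
  ∑-≈0 {zero}  h = ∑-zero _
  ∑-≈0 {suc k} h = trans (∑-suc _) (trans (+-cong (h zero) (∑-≈0 (h ∘ suc))) (+-identityˡ 0#))

  +-interchange : ∀ a b d e → (a + b) + (d + e) ≈ (a + d) + (b + e)
  +-interchange = solve 4 (λ a b d e → (a :+ b) :+ (d :+ e) := (a :+ d) :+ (b :+ e)) refl

  *-interchange : ∀ a b d e → (a * b) * (d * e) ≈ (a * d) * (b * e)
  *-interchange = solve 4 (λ a b d e → (a :* b) :* (d :* e) := (a :* d) :* (b :* e)) refl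

  ∑-+ : ∀ {k} (f g : Fin k → Carrier) → ∑ (λ i → f i + g i) ≈ ∑ f + ∑ g
  ∑-+ {zero}  f g = trans (∑-zero _) (sym (trans (+-cong (∑-zero f) (∑-zero g)) (+-identityˡ 0#)))
  ∑-+ {suc k} f g = begin
    ∑ (λ i → f i + g i)                                             ≈⟨ ∑-suc _ ⟩
    (f zero + g zero) + ∑ (λ i → f (suc i) + g (suc i))             ≈⟨ +-congˡ (∑-+ (f ∘ suc) (g ∘ suc)) ⟩
    (f zero + g zero) + (∑ (f ∘ suc) + ∑ (g ∘ suc))                 ≈⟨ +-interchange _ _ _ _ ⟩
    (f zero + ∑ (f ∘ suc)) + (g zero + ∑ (g ∘ suc))                 ≈⟨ +-cong (∑-suc f) (∑-suc g) ⟨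
    ∑ f + ∑ g                                                       ∎

  ∑-*ˡ : ∀ {k} a (f : Fin k → Carrier) → a * ∑ f ≈ ∑ (λ i → a * f i)
  ∑-*ˡ {zero}  a f = trans (*-congˡ (∑-zero f)) (trans (zeroʳ a) (sym (∑-zero _)))
  ∑-*ˡ {suc k} a f = begin
    a * ∑ f                                  ≈⟨ *-congˡ (∑-suc f) ⟩
    a * (f zero + ∑ (f ∘ suc))               ≈⟨ distribˡ a _ _ ⟩
    a * f zero + a * ∑ (f ∘ suc)             ≈⟨ +-congˡ (∑-*ˡ a (f ∘ suc)) ⟩
    a * f zero + ∑ (λ i → a * f (suc i))     ≈⟨ ∑-suc _ ⟨
    ∑ (λ i → a * f i)                        ∎

  ∑-*ʳ : ∀ {k} (f : Fin k → Carrier) a → ∑ f * a ≈ ∑ (λ i → f i * a)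
  ∑-*ʳ f a = trans (*-comm _ a) (trans (∑-*ˡ a f) (∑-cong (λ i → *-comm a (f i))))

  ∑-swap : ∀ {k l} (f : Fin k → Fin l → Carrier) →
           ∑ (λ i → ∑ (λ j → f i j)) ≈ ∑ (λ j → ∑ (λ i → f i j))
  ∑-swap {zero}  f = trans (∑-zero _) (sym (∑-≈0 (λ j → ∑-zero _)))
  ∑-swap {suc k} f = begin
    ∑ (λ i → ∑ (λ j → f i j))                              ≈⟨ ∑-suc _ ⟩
    ∑ (f zero) + ∑ (λ i → ∑ (λ j → f (suc i) j))           ≈⟨ +-congˡ (∑-swap (f ∘ suc)) ⟩
    ∑ (f zero) + ∑ (λ j → ∑ (λ i → f (suc i) j))           ≈⟨ ∑-+ (f zero) _ ⟨
    ∑ (λ j → f zero j + ∑ (λ i → f (suc i) j))             ≈⟨ ∑-cong (λ j → ∑-suc (λ i → f i j)) ⟨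
    ∑ (λ j → ∑ (λ i → f i j))                              ∎

  ∏-cong : ∀ {k} {f g : Fin k → Carrier} → (∀ i → f i ≈ g i) → ∏ f ≈ ∏ g
  ∏-cong {zero}  h = trans (∏-zero _) (sym (∏-zero _))
  ∏-cong {suc k} h = trans (∏-suc _) (trans (*-cong (h zero) (∏-cong (h ∘ suc))) (sym (∏-suc _)))

  ∏-* : ∀ {k} (f g : Fin k → Carrier) → ∏ (λ i → f i * g i) ≈ ∏ f * ∏ g
  ∏-* {zero}  f g = trans (∏-zero _) (sym (trans (*-cong (∏-zero f) (∏-zero g)) (*-identityˡ 1#)))
  ∏-* {suc k} f g = begin
    ∏ (λ i → f i * g i)                                             ≈⟨ ∏-suc _ ⟩
    (f zero * g zero) * ∏ (λ i → f (suc i) * g (suc i))             ≈⟨ *-congˡ (∏-* (f ∘ suc) (g ∘ suc)) ⟩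
    (f zero * g zero) * (∏ (f ∘ suc) * ∏ (g ∘ suc))                 ≈⟨ *-interchange _ _ _ _ ⟩
    (f zero * ∏ (f ∘ suc)) * (g zero * ∏ (g ∘ suc))                 ≈⟨ *-cong (∏-suc f) (∏-suc g) ⟨
    ∏ f * ∏ g                                                       ∎

  -- Multilinear and alternating functions of rows

  Row : ℕ → Set c
  Row n = Fin n → Carrier

  Rows : ℕ → ℕ → Set c
  Rows m n = Fin m → Row n

  infix 4 _≐_
  _≐_ : ∀ {n} → Row n → Row n → Set ℓ
  u ≐ v = ∀ p → u p ≈ v p

  consF-cong : ∀ {m n} {u u′ : Row n} {v v′ : Rows m n} →
               u ≐ u′ → (∀ j → v j ≐ v′ j) → ∀ j → consF u v j ≐ consF u′ v′ j
  consF-cong h hs zero    = h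
  consF-cong h hs (suc j) = hs j

  Respectful : ∀ {m n} → (Rows m n → Carrier) → Set (c ⊔ ℓ)
  Respectful F = ∀ {v v′} → (∀ j → v j ≐ v′ j) → F v ≈ F v′

  Multilinear : ∀ {m n} → (Rows m n → Carrier) → Set (c ⊔ ℓ)
  Multilinear {zero}  F = Level.Lift _ ⊤
  Multilinear {suc m} F =
    (∀ a u u′ v → F (consF (λ p → a * u p + u′ p) v) ≈ a * F (consF u v) + F (consF u′ v))
    × (∀ u → Multilinear (λ v → F (consF u v)))

  -- Asks only for vanishing on equal adjacent rows; `swap01` and `repeatedRow` extend this to rows
  -- further apart.
  Alternating : ∀ {m n} → (Rows m n → Carrier) → Set (c ⊔ ℓ)
  Alternating {zero}        F = Level.Lift _ ⊤
  Alternating {suc zero}    F = Level.Lift _ ⊤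
  Alternating {suc (suc m)} F =
    (∀ u v → F (consF u (consF u v)) ≈ 0#)
    × (∀ u → Alternating (λ v → F (consF u v)))

  -- Row count and row length are independent because fixing the first row lowers only the former.
  -- The field `cong` stands in for function extensionality on rows.
  record IsForm {m n} (F : Rows m n → Carrier) : Set (c ⊔ ℓ) where
    field
      cong : Respectful F
      mul  : Multilinear F
      alt  : Alternating F

  open IsForm public

  -- The determinant is multilinear and alternating

  Det-cong : ∀ {k} → Respectful (Det {k})
  Det-cong {zero}  h = trans (Det-zero _) (sym (Det-zero _))
  Det-cong {suc k} h = trans (Det-row0 _) (trans (∑-cong (λ j →
    *-congˡ (*-cong (h zero j) (Det-cong (λ a b → h (suc a) (punchIn j b)))))) (sym (Det-row0 _)))

  -- Away from the corner, expanding the minors of row 0 along column 0 by induction gives a double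
  -- sum over the entries (0, j + 1) and (i + 1, 0) times twice-deleted minors. It is symmetric in
  -- the two directions, and summed in the other order it is the column expansion.
  Det-col0 : ∀ {k} (M : Rows (suc k) (suc k)) →
             Det M ≈ ∑ (λ i → sgn R (toℕ i) *
                                (M i zero * Det (λ a b → M (punchIn i a) (suc b))))
  Det-col0 {zero}  M = trans (Det-row0 M) (∑-cong (λ { zero →
    *-congˡ (*-congˡ (trans (Det-zero _) (sym (Det-zero _)))) }))
  Det-col0 {suc k} M = begin
    Det M
      ≈⟨ trans (Det-row0 M) (∑-suc _) ⟩
    corner + ∑ (λ j → sgn R (suc (toℕ j)) * (M zero (suc j) * Det (λ a b → M (suc a) (punchIn (suc j) b))))
      ≈⟨ +-congˡ (∑-cong (λ j → trans (*-congˡ (*-congˡ (Det-col0 (λ a b → M (suc a) (punchIn (suc j) b)))))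
           (trans (*-congˡ (∑-*ˡ _ _)) (∑-*ˡ _ _)))) ⟩
    corner + ∑ (λ j → ∑ (λ i → sgn R (suc (toℕ j)) * (M zero (suc j) * (sgn R (toℕ i) * (M (suc i) zero * D i j)))))
      ≈⟨ +-congˡ (∑-cong (λ j → ∑-cong (λ i → rearrange (sgn R (toℕ j)) (M zero (suc j)) (sgn R (toℕ i)) (M (suc i) zero) (D i j)))) ⟩
    corner + ∑ (λ j → ∑ (λ i → sgn R (suc (toℕ i)) * (M (suc i) zero * (sgn R (toℕ j) * (M zero (suc j) * D i j)))))
      ≈⟨ +-congˡ (∑-swap _) ⟩
    corner + ∑ (λ i → ∑ (λ j → sgn R (suc (toℕ i)) * (M (suc i) zero * (sgn R (toℕ j) * (M zero (suc j) * D i j)))))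
      ≈⟨ +-congˡ (∑-cong (λ i → trans (*-congˡ (trans (*-congˡ (Det-row0 (λ a b → M (punchIn (suc i) a) (suc b))))
           (∑-*ˡ _ _))) (∑-*ˡ _ _))) ⟨
    corner + ∑ (λ i → sgn R (suc (toℕ i)) * (M (suc i) zero * Det (λ a b → M (punchIn (suc i) a) (suc b))))
      ≈⟨ ∑-suc _ ⟨
    ∑ (λ i → sgn R (toℕ i) * (M i zero * Det (λ a b → M (punchIn i a) (suc b)))) ∎
    where
    corner : Carrier
    corner = 1# * (M zero zero * Det (λ a b → M (suc a) (suc b)))
    D : Fin (suc k) → Fin (suc k) → Carrier
    D i j = Det (λ a b → M (suc (punchIn i a)) (suc (punchIn j b)))
    rearrange : ∀ s x t y d → (- s) * (x * (t * (y * d))) ≈ (- t) * (y * (s * (x * d)))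
    rearrange s x t y d = begin
      (- s) * (x * (t * (y * d))) ≈⟨ -‿distribˡ-* _ _ ⟨
      - (s * (x * (t * (y * d)))) ≈⟨ -‿cong (solve 5 (λ s x t y d →
           s :* (x :* (t :* (y :* d))) := t :* (y :* (s :* (x :* d)))) refl s x t y d) ⟩
      - (t * (y * (s * (x * d)))) ≈⟨ -‿distribˡ-* _ _ ⟩
      (- t) * (y * (s * (x * d))) ∎

  Multilinear-∑ : ∀ {m n k} (b : Fin k → Carrier) {G : Fin k → Rows m n → Carrier} →
                  (∀ j → Multilinear (G j)) → Multilinear (λ v → ∑ (λ j → b j * G j v))
  Multilinear-∑ {zero}  b h = _
  Multilinear-∑ {suc m} b {G} h =
    (λ a u u′ v → trans (∑-cong (λ j → trans (*-congˡ (proj₁ (h j) a u u′ v))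
        (solve 4 (λ b a x y → b :* (a :* x :+ y) := a :* (b :* x) :+ b :* y) refl (b j) a _ _)))
      (trans (∑-+ _ _) (+-congʳ (sym (∑-*ˡ a _)))))
    , (λ u → Multilinear-∑ b (λ j → proj₂ (h j) u))

  Alternating-∑ : ∀ {m n k} (b : Fin k → Carrier) {G : Fin k → Rows m n → Carrier} →
                  (∀ j → Alternating (G j)) → Alternating (λ v → ∑ (λ j → b j * G j v))
  Alternating-∑ {zero}        b h = _
  Alternating-∑ {suc zero}    b h = _
  Alternating-∑ {suc (suc m)} b h =
    (λ u v → ∑-≈0 (λ j → trans (*-congˡ (proj₁ (h j) u v)) (zeroʳ (b j))))
    , (λ u → Alternating-∑ b (λ j → proj₂ (h j) u))

  record Linear {n n′} (L : Row n → Row n′) : Set (c ⊔ ℓ) where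
    field
      lcong   : ∀ {u u′} → u ≐ u′ → L u ≐ L u′
      llinear : ∀ a u u′ → L (λ p → a * u p + u′ p) ≐ (λ p → a * L u p + L u′ p)

  open Linear public

  map-consF : ∀ {m n n′} (L : Row n → Row n′) u (v : Rows m n) →
              ∀ j → L (consF u v j) ≐ consF (L u) (λ i → L (v i)) j
  map-consF L u v zero    p = refl
  map-consF L u v (suc j) p = refl

  consF-respectful : ∀ {m n} {F : Rows (suc m) n → Carrier} → Respectful F →
                     ∀ u → Respectful (λ v → F (consF u v))
  consF-respectful F≈ u h = F≈ (consF-cong (λ _ → refl) h)

  Multilinear-resp : ∀ {m n} {F G : Rows m n → Carrier} → (∀ v → F v ≈ G v) →
                     Multilinear F → Multilinear G
  Multilinear-resp {zero}  e h = _
  Multilinear-resp {suc m} e (h , hs) =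
    (λ a u u′ v → trans (sym (e _)) (trans (h a u u′ v) (+-cong (*-congˡ (e _)) (e _))))
    , (λ u → Multilinear-resp (λ v → e _) (hs u))

  Alternating-resp : ∀ {m n} {F G : Rows m n → Carrier} → (∀ v → F v ≈ G v) →
                     Alternating F → Alternating G
  Alternating-resp {zero}        e h = _
  Alternating-resp {suc zero}    e h = _
  Alternating-resp {suc (suc m)} e (h , hs) =
    (λ u v → trans (sym (e _)) (h u v)) , (λ u → Alternating-resp (λ v → e _) (hs u))

  Multilinear-∘ : ∀ {m n n′} {L : Row n → Row n′} → Linear L → {F : Rows m n′ → Carrier} →
                  Respectful F → Multilinear F → Multilinear (λ v → F (λ j → L (v j)))
  Multilinear-∘ {zero}  lin F≈ h = _
  Multilinear-∘ {suc m} {L = L} lin {F} F≈ (h , hs) =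
    (λ a u u′ v → trans (F≈ (λ j p → trans (map-consF L _ v j p) (consF-cong (llinear lin a u u′) (λ _ _ → refl) j p)))
       (trans (h a (L u) (L u′) (λ i → L (v i)))
         (+-cong (*-congˡ (sym (F≈ (map-consF L u v)))) (sym (F≈ (map-consF L u′ v))))))
    , (λ u → Multilinear-resp (λ v → sym (F≈ (map-consF L u v)))
               (Multilinear-∘ lin (consF-respectful F≈ (L u)) (hs (L u))))

  Alternating-∘ : ∀ {m n n′} (L : Row n → Row n′) {F : Rows m n′ → Carrier} →
                  Respectful F → Alternating F → Alternating (λ v → F (λ j → L (v j)))
  Alternating-∘ {zero}        L F≈ h = _
  Alternating-∘ {suc zero}    L F≈ h = _
  Alternating-∘ {suc (suc m)} L {F} F≈ (h , hs) =
    (λ u v → trans (F≈ (λ j p → trans (map-consF L u _ j p)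
         (consF-cong (λ _ → refl) (map-consF L u v) j p)))
       (h (L u) (λ i → L (v i))))
    , (λ u → Alternating-resp (λ v → sym (F≈ (map-consF L u v)))
               (Alternating-∘ L (consF-respectful F≈ (L u)) (hs (L u))))

  Det-consF : ∀ {k} u (v : Rows k (suc k)) →
              Det (consF u v) ≈ ∑ (λ j → (sgn R (toℕ j) * u j) * Det (λ a b → v a (punchIn j b)))
  Det-consF u v = trans (Det-row0 (consF u v)) (∑-cong (λ j → sym (*-assoc (sgn R (toℕ j)) (u j) _)))

  Det-Multilinear : ∀ {k} → Multilinear (Det {k})
  Det-Multilinear {zero}  = _
  Det-Multilinear {suc k} =
    (λ a u u′ v → trans (Det-row0 _) (trans (∑-cong (λ j →
        solve 5 (λ s a x y d → s :* ((a :* x :+ y) :* d) := a :* (s :* (x :* d)) :+ s :* (y :* d)) refl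
          (sgn R (toℕ j)) a (u j) (u′ j) _))
      (trans (∑-+ _ _) (+-cong (trans (sym (∑-*ˡ a _)) (*-congˡ (sym (Det-row0 _)))) (sym (Det-row0 _))))))
    , (λ u → Multilinear-resp (λ v → sym (Det-consF u v))
         (Multilinear-∑ (λ j → sgn R (toℕ j) * u j) {λ j v → Det (λ a b → v a (punchIn j b))}
           (λ j → Multilinear-∘ (record { lcong = λ h p → h (punchIn j p) ; llinear = λ a u u′ p → refl })
                                Det-cong Det-Multilinear)))

  -- Along column 0 the first two terms have equal minors and opposite signs. Every further minor
  -- keeps the two equal rows on top, so it vanishes by induction through `equalRows-minor`.
  Det-equalRows : ∀ {k} u (v : Rows k (suc (suc k))) → Det (consF u (consF u v)) ≈ 0#

  equalRows-minor : ∀ {k} u (v : Rows k (suc (suc k))) (i : Fin k) →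
                    Det (λ a b → consF u (consF u v) (punchIn (suc (suc i)) a) (suc b)) ≈ 0#
  equalRows-minor {suc k} u v i =
    trans (Det-cong λ { zero b → refl ; (suc zero) b → refl ; (suc (suc a)) b → refl })
          (Det-equalRows (λ b → u (suc b)) (λ a b → v (punchIn i a) (suc b)))

  Det-equalRows {k} u v = begin
    Det M
      ≈⟨ trans (Det-col0 M) (trans (∑-suc _) (+-congˡ (∑-suc _))) ⟩
    1# * (u zero * D₀) + ((- 1#) * (u zero * D₁) + rest)
      ≈⟨ +-congˡ (+-cong (*-congˡ (*-congˡ (Det-cong D₁≈D₀))) (∑-≈0 rest≈0)) ⟩
    1# * (u zero * D₀) + ((- 1#) * (u zero * D₀) + 0#)
      ≈⟨ +-congˡ (+-identityʳ _) ⟩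
    1# * (u zero * D₀) + (- 1#) * (u zero * D₀)
      ≈⟨ distribʳ _ _ _ ⟨
    (1# + - 1#) * (u zero * D₀)
      ≈⟨ *-congʳ (-‿inverseʳ 1#) ⟩
    0# * (u zero * D₀)
      ≈⟨ zeroˡ _ ⟩
    0# ∎
    where
    M : Rows (suc (suc k)) (suc (suc k))
    M = consF u (consF u v)
    D₀ D₁ : Carrier
    D₀ = Det (λ a b → M (suc a) (suc b))
    D₁ = Det (λ a b → M (punchIn (suc zero) a) (suc b))
    term : Fin k → Carrier
    term i = sgn R (suc (suc (toℕ i))) * (v i zero * Det (λ a b → M (punchIn (suc (suc i)) a) (suc b)))
    rest : Carrier
    rest = ∑ term
    D₁≈D₀ : ∀ a b → M (punchIn (suc zero) a) (suc b) ≈ M (suc a) (suc b)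
    D₁≈D₀ zero    b = refl
    D₁≈D₀ (suc a) b = refl
    rest≈0 : ∀ i → term i ≈ 0#
    rest≈0 i = trans (*-congˡ (trans (*-congˡ (equalRows-minor u v i)) (zeroʳ _))) (zeroʳ _)

  Det-Alternating : ∀ {k} → Alternating (Det {k})
  Det-Alternating {zero}        = _
  Det-Alternating {suc zero}    = _
  Det-Alternating {suc (suc k)} =
    Det-equalRows
    , (λ u → Alternating-resp (λ v → sym (Det-consF u v))
         (Alternating-∑ (λ j → sgn R (toℕ j) * u j) {λ j v → Det (λ a b → v a (punchIn j b))}
           (λ j → Alternating-∘ (λ r p → r (punchIn j p)) Det-cong Det-Alternating)))

  Det-IsForm : ∀ {k} → IsForm (Det {k})
  Det-IsForm = record { cong = Det-cong ; mul = Det-Multilinear ; alt = Det-Alternating }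

  -- Determinants as alternating forms

  IsForm-tail : ∀ {m n} {F : Rows (suc m) n → Carrier} → IsForm F →
                ∀ u → IsForm (λ v → F (consF u v))
  IsForm-tail {m} {F = F} φ u = record
    { cong = consF-respectful {F = F} (cong φ) u ; mul = proj₂ (mul φ) u ; alt = tail-alt m F (alt φ) }
    where
    tail-alt : ∀ m {n} {u : Row n} (F : Rows (suc m) n → Carrier) → Alternating F → Alternating (λ v → F (consF u v))
    tail-alt zero    F h = _
    tail-alt (suc m) F h = proj₂ h _

  IsForm-∘ : ∀ {m n n′} {L : Row n → Row n′} → Linear L → {F : Rows m n′ → Carrier} →
             IsForm F → IsForm (λ v → F (λ j → L (v j)))
  IsForm-∘ {L = L} lin {F} φ = record
    { cong = λ h → cong φ (λ j → lcong lin (h j))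
    ; mul  = Multilinear-∘ lin {F} (cong φ) (mul φ)
    ; alt  = Alternating-∘ L {F} (cong φ) (alt φ)
    }

  consF-η : ∀ {m n} (v : Rows (suc m) n) → ∀ j → v j ≐ consF (v zero) (λ i → v (suc i)) j
  consF-η v zero    p = refl
  consF-η v (suc j) p = refl

  module _ {m n} {F : Rows (suc m) n → Carrier} (φ : IsForm F) where

    row0-+ : ∀ u u′ v → F (consF (λ p → u p + u′ p) v) ≈ F (consF u v) + F (consF u′ v)
    row0-+ u u′ v = begin
      F (consF (λ p → u p + u′ p) v)       ≈⟨ cong φ (consF-cong (λ p → +-congʳ (sym (*-identityˡ (u p)))) (λ _ _ → refl)) ⟩
      F (consF (λ p → 1# * u p + u′ p) v)  ≈⟨ proj₁ (mul φ) 1# u u′ v ⟩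
      1# * F (consF u v) + F (consF u′ v)  ≈⟨ +-congʳ (*-identityˡ _) ⟩
      F (consF u v) + F (consF u′ v)       ∎

    row0-zero : ∀ v → F (consF (λ _ → 0#) v) ≈ 0#
    row0-zero v = x+x≈x⇒x≈0 _ (trans (sym (row0-+ _ _ v))
      (cong φ (consF-cong (λ _ → +-identityˡ 0#) (λ _ _ → refl))))

    row0-∑ : ∀ {k} (b : Fin k → Carrier) (w : Rows k n) v →
             F (consF (λ p → ∑ (λ i → b i * w i p)) v) ≈ ∑ (λ i → b i * F (consF (w i) v))
    row0-∑ {zero}  b w v = trans (cong φ (consF-cong (λ p → ∑-zero _) (λ _ _ → refl)))
      (trans (row0-zero v) (sym (∑-zero _)))
    row0-∑ {suc k} b w v = begin
      F (consF (λ p → ∑ (λ i → b i * w i p)) v)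
        ≈⟨ cong φ (consF-cong (λ p → ∑-suc _) (λ _ _ → refl)) ⟩
      F (consF (λ p → b zero * w zero p + ∑ (λ i → b (suc i) * w (suc i) p)) v)
        ≈⟨ proj₁ (mul φ) _ _ _ v ⟩
      b zero * F (consF (w zero) v) + F (consF (λ p → ∑ (λ i → b (suc i) * w (suc i) p)) v)
        ≈⟨ +-congˡ (row0-∑ (b ∘ suc) (w ∘ suc) v) ⟩
      b zero * F (consF (w zero) v) + ∑ (λ i → b (suc i) * F (consF (w (suc i)) v))
        ≈⟨ ∑-suc _ ⟨
      ∑ (λ i → b i * F (consF (w i) v)) ∎

  -- Polarisation: F vanishes when both leading rows are u + w, and so do the terms with u twice or
  -- w twice.
  swap01 : ∀ {m n} {F : Rows (suc (suc m)) n → Carrier} → IsForm F →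
           ∀ u w v → F (consF u (consF w v)) ≈ - F (consF w (consF u v))
  swap01 {F = F} φ u w v = begin
    uw                        ≈⟨ +-identityʳ _ ⟨
    uw + 0#                   ≈⟨ +-congˡ (-‿inverseʳ wu) ⟨
    uw + (wu + - wu)          ≈⟨ +-assoc _ _ _ ⟨
    (uw + wu) + - wu          ≈⟨ +-congʳ uw+wu≈0 ⟩
    0# + - wu                 ≈⟨ +-identityˡ _ ⟩
    - wu                      ∎
    where
    s : _
    s p = u p + w p
    uw wu : Carrier
    uw = F (consF u (consF w v))
    wu = F (consF w (consF u v))
    half : ∀ r → F (consF r (consF s v)) ≈ F (consF r (consF u v)) + F (consF r (consF w v))
    half r = row0-+ (IsForm-tail φ r) u w v
    uw+wu≈0 : uw + wu ≈ 0#
    uw+wu≈0 = begin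
      uw + wu                                                     ≈⟨ +-cong (+-identityˡ uw) (+-identityʳ wu) ⟨
      (0# + uw) + (wu + 0#)                                       ≈⟨ +-cong (+-congʳ (proj₁ (alt φ) u v)) (+-congˡ (proj₁ (alt φ) w v)) ⟨
      (F (consF u (consF u v)) + uw) + (wu + F (consF w (consF w v)))  ≈⟨ +-cong (half u) (half w) ⟨
      F (consF u (consF s v)) + F (consF w (consF s v))           ≈⟨ row0-+ φ u w (consF s v) ⟨
      F (consF s (consF s v))                                     ≈⟨ proj₁ (alt φ) s v ⟩
      0#                                                          ∎

  -- The row u moves down past the rows above its copy, one swap at a time, until the two are
  -- adjacent.
  repeatedRow : ∀ {m n} {F : Rows (suc m) n → Carrier} → IsForm F →
                ∀ u v j → v j ≐ u → F (consF u v) ≈ 0#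
  repeatedRow {suc m} {F = F} φ u v zero h = trans
    (cong φ (consF-cong (λ _ → refl) λ { zero → h ; (suc j) p → refl }))
    (proj₁ (alt φ) u (v ∘ suc))
  repeatedRow {suc m} {F = F} φ u v (suc j) h = begin
    F (consF u v)                                ≈⟨ cong φ (consF-cong (λ _ → refl) (consF-η v)) ⟩
    F (consF u (consF (v zero) (v ∘ suc)))       ≈⟨ swap01 φ u (v zero) (v ∘ suc) ⟩
    - F (consF (v zero) (consF u (v ∘ suc)))     ≈⟨ -‿cong (repeatedRow (IsForm-tail φ (v zero)) u (v ∘ suc) j h) ⟩
    - 0#                                         ≈⟨ -0#≈0# ⟩
    0#                                           ∎

  -- The row u is not among v: it sits outside, as the fixed first row of a larger form. Hence the
  -- vanishing hypothesis `kill` instead of a repeated row.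
  addMultiples : ∀ {m n} {F : Rows m n → Carrier} → IsForm F → ∀ u →
                 (∀ v j → v j ≐ u → F v ≈ 0#) →
                 ∀ (a : Fin m → Carrier) v → F (λ j p → a j * u p + v j p) ≈ F v
  addMultiples {zero}  φ u kill a v = cong φ (λ ())
  addMultiples {suc m} {F = F} φ u kill a v = begin
    F (λ j p → a j * u p + v j p)
      ≈⟨ cong φ (consF-η _) ⟩
    F (consF (λ p → a zero * u p + v zero p) (λ j p → a (suc j) * u p + v (suc j) p))
      ≈⟨ proj₁ (mul φ) _ _ _ _ ⟩
    a zero * F (consF u (λ j p → a (suc j) * u p + v (suc j) p))
      + F (consF (v zero) (λ j p → a (suc j) * u p + v (suc j) p))
      ≈⟨ +-cong (trans (*-congˡ (kill _ zero (λ _ → refl))) (zeroʳ _))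
           (addMultiples (IsForm-tail φ (v zero)) u (λ w j h → kill _ (suc j) h) (a ∘ suc) (v ∘ suc)) ⟩
    0# + F (consF (v zero) (v ∘ suc))
      ≈⟨ +-identityˡ _ ⟩
    F (consF (v zero) (v ∘ suc))
      ≈⟨ cong φ (consF-η v) ⟨
    F v ∎

  toFront : ∀ {m n} {F : Rows (suc m) n → Carrier} → IsForm F → ∀ (v : Rows (suc m) n) k →
            F (consF (v k) (λ j → v (punchIn k j))) ≈ sgn R (toℕ k) * F v
  toFront φ v zero = trans (cong φ (λ j p → sym (consF-η v j p))) (sym (*-identityˡ _))
  toFront {suc m} {F = F} φ v (suc k) = begin
    F (consF (v (suc k)) (λ j → v (punchIn (suc k) j)))
      ≈⟨ cong φ (consF-cong (λ _ → refl) (consF-η _)) ⟩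
    F (consF (v (suc k)) (consF (v zero) (λ j → v (suc (punchIn k j)))))
      ≈⟨ swap01 φ _ _ _ ⟩
    - F (consF (v zero) (consF (v (suc k)) (λ j → v (suc (punchIn k j)))))
      ≈⟨ -‿cong (toFront (IsForm-tail φ (v zero)) (v ∘ suc) k) ⟩
    - (sgn R (toℕ k) * F (consF (v zero) (v ∘ suc)))
      ≈⟨ -‿cong (*-congˡ (cong φ (consF-η v))) ⟨
    - (sgn R (toℕ k) * F v)
      ≈⟨ -‿distribˡ-* _ _ ⟩
    (- sgn R (toℕ k)) * F v ∎

  -- Uniqueness of alternating forms and the product rule

  δ : ∀ {n} → Rows n n
  δ zero    zero    = 1#
  δ zero    (suc j) = 0#
  δ (suc i) zero    = 0#
  δ (suc i) (suc j) = δ i j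

  ∑-δ : ∀ {n k} (i : Fin n) (w : Rows n k) p → ∑ (λ j → δ i j * w j p) ≈ w i p
  ∑-δ zero w p = trans (∑-suc _) (trans (+-cong (*-identityˡ _) (∑-≈0 (λ j → zeroˡ _))) (+-identityʳ _))
  ∑-δ (suc i) w p = trans (∑-suc _) (trans (+-cong (zeroˡ _) (∑-δ i (w ∘ suc) p)) (+-identityˡ _))

  ∑-*δ : ∀ {n} (r : Row n) p → ∑ (λ j → r j * δ j p) ≈ r p
  ∑-*δ r zero    = trans (∑-suc _) (trans (+-cong (*-identityʳ _) (∑-≈0 (λ j → zeroʳ _))) (+-identityʳ _))
  ∑-*δ r (suc p) = trans (∑-suc _) (trans (+-cong (zeroʳ _) (∑-*δ (r ∘ suc) p)) (+-identityˡ _))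

  δ-refl : ∀ {n} (k : Fin n) → δ k k ≈ 1#
  δ-refl zero    = refl
  δ-refl (suc k) = δ-refl k

  δ-punchInˡ : ∀ {n} (k : Fin (suc n)) j → δ (punchIn k j) k ≈ 0#
  δ-punchInˡ zero    j       = refl
  δ-punchInˡ (suc k) zero    = refl
  δ-punchInˡ (suc k) (suc j) = δ-punchInˡ k j

  δ-punchInʳ : ∀ {n} (k : Fin (suc n)) j → δ k (punchIn k j) ≈ 0#
  δ-punchInʳ zero    j       = refl
  δ-punchInʳ (suc k) zero    = refl
  δ-punchInʳ (suc k) (suc j) = δ-punchInʳ k j

  δ-punchIn : ∀ {n} (k : Fin (suc n)) i j → δ (punchIn k i) (punchIn k j) ≈ δ i j
  δ-punchIn zero    i       j       = refl
  δ-punchIn (suc k) zero    zero    = refl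
  δ-punchIn (suc k) zero    (suc j) = refl
  δ-punchIn (suc k) (suc i) zero    = refl
  δ-punchIn (suc k) (suc i) (suc j) = δ-punchIn k i j

  -- A row of a minor, seen as a row of the full matrix whose entry in column k has been cleared.
  ins : ∀ {n} → Fin (suc n) → Row n → Row (suc n)
  ins k r = insertAt r k 0#

  ins-at : ∀ {n} (k : Fin (suc n)) r → ins k r k ≈ 0#
  ins-at k r = reflexive (VecF.insertAt-lookup r k 0#)

  ins-punchIn : ∀ {n} (k : Fin (suc n)) r q → ins k r (punchIn k q) ≈ r q
  ins-punchIn k r q = reflexive (VecF.insertAt-punchIn r k 0# q)

  ins-linear : ∀ {n} (k : Fin (suc n)) → Linear (ins k)
  ins-linear k = record
    { lcong = λ {u} {u′} h → punchIn-elim _ k (trans (ins-at k u) (sym (ins-at k u′)))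
        (λ q → trans (ins-punchIn k u q) (trans (h q) (sym (ins-punchIn k u′ q))))
    ; llinear = λ a u u′ → punchIn-elim _ k
        (trans (ins-at k _) (sym (trans (+-cong (trans (*-congˡ (ins-at k u)) (zeroʳ a)) (ins-at k u′)) (+-identityˡ 0#))))
        (λ q → trans (ins-punchIn k _ q) (sym (+-cong (*-congˡ (ins-punchIn k u q)) (ins-punchIn k u′ q))))
    }

  -- Row 0 is expanded in unit vectors. With `δ k` on top, multiples of it clear column k in the
  -- other rows, so what remains is a form in the minor and induction applies. Moving `δ k` back to
  -- its place yields the cofactor sign.
  form-unique : ∀ {n} {F : Rows n n → Carrier} → IsForm F → ∀ v → F v ≈ Det v * F δ
  form-unique {zero}  φ v = trans (cong φ (λ ())) (sym (trans (*-congʳ (Det-zero v)) (*-identityˡ _)))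
  form-unique {suc n} {F} φ v = begin
    F v
      ≈⟨ cong φ (λ { zero p → sym (∑-*δ (v zero) p) ; (suc j) p → refl }) ⟩
    F (consF (λ p → ∑ (λ k → v zero k * δ k p)) (v ∘ suc))
      ≈⟨ row0-∑ φ (v zero) δ (v ∘ suc) ⟩
    ∑ (λ k → v zero k * F (consF (δ k) (v ∘ suc)))
      ≈⟨ ∑-cong (λ k → trans (*-congˡ (step k))
           (solve 4 (λ a d s f → a :* (d :* (s :* f)) := (s :* (a :* d)) :* f) refl (v zero k) _ _ _)) ⟩
    ∑ (λ k → (sgn R (toℕ k) * (v zero k * Det (minor k))) * F δ)
      ≈⟨ ∑-*ʳ _ _ ⟨
    ∑ (λ k → sgn R (toℕ k) * (v zero k * Det (minor k))) * F δ
      ≈⟨ *-congʳ (Det-row0 v) ⟨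
    Det v * F δ ∎
    where
    minor : ∀ k → Rows n n
    minor k a b = v (suc a) (punchIn k b)
    G : Fin (suc n) → Rows n n → Carrier
    G k w = F (consF (δ k) (λ j → ins k (w j)))
    split : ∀ k j p → v (suc j) p ≈ v (suc j) k * δ k p + ins k (minor k j) p
    split k j = punchIn-elim _ k
      (sym (trans (+-cong (trans (*-congˡ (δ-refl k)) (*-identityʳ _)) (ins-at k _)) (+-identityʳ _)))
      (λ q → sym (trans (+-cong (trans (*-congˡ (δ-punchInʳ k q)) (zeroʳ _)) (ins-punchIn k _ q)) (+-identityˡ _)))
    ins-δ : ∀ k j → ins k (δ j) ≐ δ (punchIn k j)
    ins-δ k j = punchIn-elim _ k (trans (ins-at k _) (sym (δ-punchInˡ k j)))
      (λ q → trans (ins-punchIn k _ q) (sym (δ-punchIn k j q)))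
    step : ∀ k → F (consF (δ k) (v ∘ suc)) ≈ Det (minor k) * (sgn R (toℕ k) * F δ)
    step k = begin
      F (consF (δ k) (v ∘ suc))
        ≈⟨ cong φ (consF-cong (λ _ → refl) (split k)) ⟩
      F (consF (δ k) (λ j p → v (suc j) k * δ k p + ins k (minor k j) p))
        ≈⟨ addMultiples (IsForm-tail φ (δ k)) (δ k) (λ w j h → repeatedRow φ (δ k) w j h) _ _ ⟩
      G k (minor k)
        ≈⟨ form-unique (IsForm-∘ (ins-linear k) (IsForm-tail φ (δ k))) (minor k) ⟩
      Det (minor k) * G k δ
        ≈⟨ *-congˡ (cong φ (consF-cong (λ _ → refl) (ins-δ k))) ⟩
      Det (minor k) * F (consF (δ k) (λ j → δ (punchIn k j)))
        ≈⟨ *-congˡ (toFront φ δ k) ⟩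
      Det (minor k) * (sgn R (toℕ k) * F δ) ∎

  -- For fixed B, the determinant of A B is an alternating form in the rows of A, with value `Det B`
  -- at the identity.
  Det-* : ∀ {n} (A B : Rows n n) → Det (λ j p → ∑ (λ k → A j k * B k p)) ≈ Det A * Det B
  Det-* A B = trans (form-unique (IsForm-∘ linear Det-IsForm) A) (*-congˡ (Det-cong (λ i p → ∑-δ i B p)))
    where
    linear : Linear (λ r p → ∑ (λ k → r k * B k p))
    linear = record
      { lcong = λ h p → ∑-cong (λ k → *-congʳ (h k))
      ; llinear = λ a u u′ p → trans (∑-cong (λ k →
            solve 4 (λ a x y b → (a :* x :+ y) :* b := a :* (x :* b) :+ y :* b) refl a (u k) (u′ k) (B k p)))
          (trans (∑-+ _ _) (+-congʳ (sym (∑-*ˡ a _))))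
      }

  -- The tail is restored before row 0, so the row whose multiple is then removed from row 0 is
  -- present unchanged.
  rowReduce : ∀ {m n} {F : Rows (suc m) n → Carrier} → IsForm F →
              ∀ (b : Fin m → Carrier) {v w : Rows (suc m) n} →
              (∀ i → w (inject₁ i) ≐ (λ p → b i * v (suc i) p + v (inject₁ i) p)) →
              w (lastF m) ≐ v (lastF m) → F w ≈ F v
  rowReduce {zero}  φ b h hl = cong φ (λ { zero → hl })
  rowReduce {suc m} {F = F} φ b {v} {w} h hl = begin
    F w
      ≈⟨ cong φ (consF-η w) ⟩
    F (consF (w zero) (w ∘ suc))
      ≈⟨ rowReduce (IsForm-tail φ (w zero)) (b ∘ suc) (λ i → h (suc i)) hl ⟩
    F (consF (w zero) (v ∘ suc))
      ≈⟨ cong φ (consF-cong (h zero) (λ _ _ → refl)) ⟩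
    F (consF (λ p → b zero * v (suc zero) p + v zero p) (v ∘ suc))
      ≈⟨ proj₁ (mul φ) _ _ _ _ ⟩
    b zero * F (consF (v (suc zero)) (v ∘ suc)) + F (consF (v zero) (v ∘ suc))
      ≈⟨ +-congʳ (trans (*-congˡ (repeatedRow φ (v (suc zero)) (v ∘ suc) zero (λ _ → refl))) (zeroʳ _)) ⟩
    0# + F (consF (v zero) (v ∘ suc))
      ≈⟨ +-identityˡ _ ⟩
    F (consF (v zero) (v ∘ suc))
      ≈⟨ cong φ (consF-η v) ⟨
    F v ∎

  -- Sums over boxes of integer vectors

  ∑≤ : ℕ → (ℕ → Carrier) → Carrier
  ∑≤ l f = ∑ {suc l} (λ i → f (toℕ i))

  ∑≤-suc : ∀ l f → ∑≤ (suc l) f ≈ f 0 + ∑≤ l (f ∘ suc)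
  ∑≤-suc l f = ∑-suc _

  ∑≤-zero : ∀ f → ∑≤ 0 f ≈ f 0
  ∑≤-zero f = trans (∑-suc _) (trans (+-congˡ (∑-zero _)) (+-identityʳ _))

  ∑≤-last : ∀ l f → ∑≤ (suc l) f ≈ ∑≤ l f + f (suc l)
  ∑≤-last zero    f = trans (∑≤-suc 0 f) (+-cong (sym (∑≤-zero f)) (∑≤-zero (f ∘ suc)))
  ∑≤-last (suc l) f = begin
    ∑≤ (suc (suc l)) f                              ≈⟨ ∑≤-suc _ f ⟩
    f 0 + ∑≤ (suc l) (f ∘ suc)                      ≈⟨ +-congˡ (∑≤-last l (f ∘ suc)) ⟩
    f 0 + (∑≤ l (f ∘ suc) + f (suc (suc l)))        ≈⟨ +-assoc _ _ _ ⟨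
    (f 0 + ∑≤ l (f ∘ suc)) + f (suc (suc l))        ≈⟨ +-congʳ (∑≤-suc l f) ⟨
    ∑≤ (suc l) f + f (suc (suc l))                  ∎

  -- Interlacing shapes are enumerated as all vectors below l, and `branchWeight` removes those that
  -- violate the lower bounds. This gives the determinant and the tableaux the same index set.
  ∑Box : ∀ {m} → (Fin m → ℕ) → ((Fin m → ℕ) → Carrier) → Carrier
  ∑Box {zero}  l g = g (λ ())
  ∑Box {suc m} l g = ∑≤ (l zero) (λ t → ∑Box (l ∘ suc) (λ μ → g (consF t μ)))

  ∑Box-cong≤ : ∀ {m} (l : Fin m → ℕ) {g h : (Fin m → ℕ) → Carrier} →
               (∀ μ → (∀ i → μ i ℕ.≤ l i) → g μ ≈ h μ) → ∑Box l g ≈ ∑Box l h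
  ∑Box-cong≤ {zero}  l e = e _ (λ ())
  ∑Box-cong≤ {suc m} l e = ∑-cong (λ t → ∑Box-cong≤ (l ∘ suc) (λ μ μ≤l →
    e _ (λ { zero → ℕP.≤-pred (FinP.toℕ<n t) ; (suc i) → μ≤l i })))

  ∑Box-cong : ∀ {m} (l : Fin m → ℕ) {g h : (Fin m → ℕ) → Carrier} →
              (∀ μ → g μ ≈ h μ) → ∑Box l g ≈ ∑Box l h
  ∑Box-cong l e = ∑Box-cong≤ l (λ μ _ → e μ)

  ∑Box-*ˡ : ∀ {m} (l : Fin m → ℕ) a (g : (Fin m → ℕ) → Carrier) →
            a * ∑Box l g ≈ ∑Box l (λ μ → a * g μ)
  ∑Box-*ˡ {zero}  l a g = refl
  ∑Box-*ˡ {suc m} l a g = trans (∑-*ˡ a _) (∑-cong (λ t → ∑Box-*ˡ (l ∘ suc) a _))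

  expandRows : ∀ {m n} {F : Rows m n → Carrier} → IsForm F → ∀ (l : Fin m → ℕ)
               (b : Fin m → ℕ → Carrier) (w : Fin m → ℕ → Row n) →
               F (λ j p → ∑≤ (l j) (λ t → b j t * w j t p)) ≈
               ∑Box l (λ μ → ∏ (λ j → b j (μ j)) * F (λ j → w j (μ j)))
  expandRows {zero}  φ l b w = trans (cong φ (λ ())) (sym (trans (*-congʳ (∏-zero _)) (*-identityˡ _)))
  expandRows {suc m} {F = F} φ l b w = begin
    F (λ j p → ∑≤ (l j) (λ t → b j t * w j t p))
      ≈⟨ cong φ (consF-η _) ⟩
    F (consF (λ p → ∑≤ (l zero) (λ t → b zero t * w zero t p)) rest)
      ≈⟨ row0-∑ φ _ (λ i → w zero (toℕ i)) rest ⟩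
    ∑≤ (l zero) (λ t → b zero t * F (consF (w zero t) rest))
      ≈⟨ ∑-cong (λ i → step (toℕ i)) ⟩
    ∑≤ (l zero) (λ t → ∑Box (l ∘ suc) (λ μ →
      ∏ (λ j → b j (consF t μ j)) * F (λ j → w j (consF t μ j)))) ∎
    where
    rest : Rows m _
    rest j p = ∑≤ (l (suc j)) (λ t → b (suc j) t * w (suc j) t p)
    step : ∀ t → b zero t * F (consF (w zero t) rest) ≈
           ∑Box (l ∘ suc) (λ μ → ∏ (λ j → b j (consF t μ j)) * F (λ j → w j (consF t μ j)))
    step t = begin
      b zero t * F (consF (w zero t) rest)
        ≈⟨ *-congˡ (expandRows (IsForm-tail φ (w zero t)) (l ∘ suc) (b ∘ suc) (w ∘ suc)) ⟩
      b zero t * ∑Box (l ∘ suc) (λ μ → ∏ (λ j → b (suc j) (μ j)) * F (consF (w zero t) (λ j → w (suc j) (μ j))))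
        ≈⟨ ∑Box-*ˡ (l ∘ suc) _ _ ⟩
      ∑Box (l ∘ suc) (λ μ → b zero t * (∏ (λ j → b (suc j) (μ j)) * F (consF (w zero t) (λ j → w (suc j) (μ j)))))
        ≈⟨ ∑Box-cong (l ∘ suc) (λ μ → trans (sym (*-assoc _ _ _)) (*-cong (sym (∏-suc _))
             (cong φ (λ { zero p → refl ; (suc j) p → refl })))) ⟩
      ∑Box (l ∘ suc) (λ μ → ∏ (λ j → b j (consF t μ j)) * F (λ j → w j (consF t μ j))) ∎

  -- The operators S - x and Newton interpolation

  Δ : Carrier → (ℕ → Carrier) → ℕ → Carrier
  Δ x φ a = φ (suc a) + (- x) * φ a

  Δs : ∀ {N} → Row N → (ℕ → Carrier) → ℕ → Carrier
  Δs {zero}  x φ = φ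
  Δs {suc N} x φ = Δs (x ∘ suc) (Δ (x zero) φ)

  -- The right inverse of S - x with value 0 at 0; explicitly the sum of x^(a-1-b) ψ b over b < a.
  H : Carrier → (ℕ → Carrier) → ℕ → Carrier
  H x ψ zero    = 0#
  H x ψ (suc a) = x * H x ψ a + ψ a

  -- The divided difference of tᵃ at x₀, …, xₚ, which equals h_{a−p}(x₀, …, xₚ).
  V : ∀ {N} → Row N → ℕ → Row N
  V x a zero    = pow R (x zero) a
  V x a (suc p) = H (x zero) (λ b → V (x ∘ suc) b p) a

  -- The functional uₖ: the product of S - xᵢ over i < k is applied to φ and the result evaluated at
  -- 0.
  newtonCoeff : ∀ {N} → Row N → (ℕ → Carrier) → Row N
  newtonCoeff x φ zero    = φ 0
  newtonCoeff x φ (suc p) = newtonCoeff (x ∘ suc) (Δ (x zero) φ) p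

  Killed : ∀ {N} → Row N → (ℕ → Carrier) → Set ℓ
  Killed x φ = ∀ a → Δs x φ a ≈ 0#

  Δ-cong : ∀ {x y} {φ ψ : ℕ → Carrier} → x ≈ y → (∀ a → φ a ≈ ψ a) → ∀ a → Δ x φ a ≈ Δ y ψ a
  Δ-cong e h a = +-cong (h (suc a)) (*-cong (-‿cong e) (h a))

  Δs-cong : ∀ {N} {x y : Row N} {φ ψ : ℕ → Carrier} → x ≐ y → (∀ a → φ a ≈ ψ a) → ∀ a → Δs x φ a ≈ Δs y ψ a
  Δs-cong {zero}  e h = h
  Δs-cong {suc N} e h = Δs-cong (λ i → e (suc i)) (Δ-cong (e zero) h)

  Δ-comm : ∀ x y φ a → Δ x (Δ y φ) a ≈ Δ y (Δ x φ) a
  Δ-comm x y φ a = solve 5 (λ x y p q r →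
    (p :+ y :* q) :+ x :* (q :+ y :* r) := (p :+ x :* q) :+ y :* (q :+ x :* r)) refl
    (- x) (- y) (φ (suc (suc a))) (φ (suc a)) (φ a)

  Δs-Δ : ∀ {N} (x : Row N) y φ a → Δs x (Δ y φ) a ≈ Δ y (Δs x φ) a
  Δs-Δ {zero}  x y φ a = refl
  Δs-Δ {suc N} x y φ a = trans (Δs-cong {x = x ∘ suc} (λ _ → refl) (Δ-comm (x zero) y φ) a) (Δs-Δ (x ∘ suc) y _ a)

  Δs-last : ∀ {N} (x : Row (suc N)) φ a → Δs x φ a ≈ Δ (x (lastF N)) (Δs (x ∘ inject₁) φ) a
  Δs-last {zero}  x φ a = refl
  Δs-last {suc N} x φ a = Δs-last (x ∘ suc) (Δ (x zero) φ) a

  -- The factors S - xᵢ commute, so the recurrence does not depend on the order of the nodes.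
  Δs-opposite : ∀ {N} (x : Row N) φ a → Δs (x ∘ opposite) φ a ≈ Δs x φ a
  Δs-opposite {zero}  x φ a = refl
  Δs-opposite {suc N} x φ a = begin
    Δs (λ i → x (inject₁ (opposite i))) (Δ (x (lastF N)) φ) a  ≈⟨ Δs-opposite (x ∘ inject₁) _ a ⟩
    Δs (x ∘ inject₁) (Δ (x (lastF N)) φ) a                     ≈⟨ Δs-Δ (x ∘ inject₁) _ φ a ⟩
    Δ (x (lastF N)) (Δs (x ∘ inject₁) φ) a                     ≈⟨ Δs-last x φ a ⟨
    Δs x φ a                                                   ∎

  H-cong : ∀ x {φ ψ : ℕ → Carrier} → (∀ a → φ a ≈ ψ a) → ∀ a → H x φ a ≈ H x ψ a
  H-cong x h zero    = refl
  H-cong x h (suc a) = +-cong (*-congˡ (H-cong x h a)) (h a)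

  H-∑ : ∀ {N} x (ψ : Fin N → ℕ → Carrier) (b : Fin N → Carrier) a →
        H x (λ a → ∑ (λ k → ψ k a * b k)) a ≈ ∑ (λ k → H x (ψ k) a * b k)
  H-∑ x ψ b zero    = sym (∑-≈0 (λ k → zeroˡ _))
  H-∑ x ψ b (suc a) = begin
    x * H x (λ a → ∑ (λ k → ψ k a * b k)) a + ∑ (λ k → ψ k a * b k)
      ≈⟨ +-congʳ (trans (*-congˡ (H-∑ x ψ b a)) (∑-*ˡ x _)) ⟩
    ∑ (λ k → x * (H x (ψ k) a * b k)) + ∑ (λ k → ψ k a * b k)
      ≈⟨ ∑-+ _ _ ⟨
    ∑ (λ k → x * (H x (ψ k) a * b k) + ψ k a * b k)
      ≈⟨ ∑-cong (λ k → trans (+-congʳ (sym (*-assoc _ _ _))) (sym (distribʳ _ _ _))) ⟩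
    ∑ (λ k → H x (ψ k) (suc a) * b k) ∎

  -- Solution of the first-order recurrence with right-hand side `Δ x φ`: the homogeneous solution
  -- with initial value φ 0 plus the particular solution given by `H`.
  pow-H-Δ : ∀ x φ a → φ a ≈ pow R x a * φ 0 + H x (Δ x φ) a
  pow-H-Δ x φ zero    = sym (trans (+-identityʳ _) (*-identityˡ _))
  pow-H-Δ x φ (suc a) = begin
    φ (suc a)                                                  ≈⟨ +-identityʳ _ ⟨
    φ (suc a) + 0#                                             ≈⟨ +-congˡ (trans (*-congʳ (-‿inverseˡ x)) (zeroˡ _)) ⟨
    φ (suc a) + (- x + x) * φ a                                ≈⟨ solve 4 (λ p m x q → p :+ (m :+ x) :* q := x :* q :+ (p :+ m :* q)) refl _ _ _ _ ⟩
    x * φ a + Δ x φ a                                          ≈⟨ +-congʳ (*-congˡ (pow-H-Δ x φ a)) ⟩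
    x * (pow R x a * φ 0 + H x (Δ x φ) a) + Δ x φ a            ≈⟨ solve 5 (λ x p q h d → x :* (p :* q :+ h) :+ d := (x :* p) :* q :+ (x :* h :+ d)) refl x _ _ _ _ ⟩
    pow R x (suc a) * φ 0 + H x (Δ x φ) (suc a)                ∎

  -- `pow-H-Δ` splits off one node at a time. Once no node is left, `Killed` says that the remaining
  -- sequence is zero, so the expansion stops without remainder.
  newton : ∀ {N} (x : Row N) φ → Killed x φ → ∀ a → φ a ≈ ∑ (λ k → V x a k * newtonCoeff x φ k)
  newton {zero}  x φ h a = trans (h a) (sym (∑-zero _))
  newton {suc N} x φ h a = begin
    φ a
      ≈⟨ pow-H-Δ (x zero) φ a ⟩
    pow R (x zero) a * φ 0 + H (x zero) (Δ (x zero) φ) a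
      ≈⟨ +-congˡ (H-cong (x zero) (newton (x ∘ suc) (Δ (x zero) φ) h) a) ⟩
    pow R (x zero) a * φ 0 + H (x zero) (λ b → ∑ (λ k → V (x ∘ suc) b k * newtonCoeff (x ∘ suc) (Δ (x zero) φ) k)) a
      ≈⟨ +-congˡ (H-∑ (x zero) (λ k b → V (x ∘ suc) b k) (newtonCoeff (x ∘ suc) (Δ (x zero) φ)) a) ⟩
    pow R (x zero) a * φ 0 + ∑ (λ k → V x a (suc k) * newtonCoeff x φ (suc k))
      ≈⟨ ∑-suc _ ⟨
    ∑ (λ k → V x a k * newtonCoeff x φ k) ∎

  Det-Killed : ∀ {N} (x : Row N) (φ : Fin N → ℕ → Carrier) → (∀ p → Killed x (φ p)) → ∀ (e : Fin N → ℕ) →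
               Det (λ j p → φ p (e j)) ≈ Det (λ j → V x (e j)) * Det (λ k p → newtonCoeff x (φ p) k)
  Det-Killed x φ h e = trans (Det-cong (λ j p → newton x (φ p) (h p) (e j))) (Det-* _ _)

  ind : ∀ {a} {P : Set a} → Dec P → Carrier → Carrier
  ind (yes _) a = a
  ind (no _)  a = 0#

  ind-yes : ∀ {a} {P : Set a} (d : Dec P) {z} → P → ind d z ≈ z
  ind-yes (yes _) p = refl
  ind-yes (no ¬p) p = contradiction p ¬p

  ind-no : ∀ {a} {P : Set a} (d : Dec P) {z} → ¬ P → ind d z ≈ 0#
  ind-no (yes p) ¬p = contradiction p ¬p
  ind-no (no _)  ¬p = refl

  ind-*ˡ : ∀ {a} {P : Set a} (d : Dec P) b z → b * ind d z ≈ ind d (b * z)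
  ind-*ˡ (yes _) b z = refl
  ind-*ˡ (no _)  b z = zeroʳ b

  ind-cong : ∀ {a} {P : Set a} (d : Dec P) {z z′} → z ≈ z′ → ind d z ≈ ind d z′
  ind-cong (yes _) h = h
  ind-cong (no _)  h = refl

  -- Row reduction and branching of the determinant

  pow-+ : ∀ x a b → pow R x (a ℕ.+ b) ≈ pow R x a * pow R x b
  pow-+ x zero    b = sym (*-identityˡ _)
  pow-+ x (suc a) b = trans (*-congˡ (pow-+ x a b)) (sym (*-assoc _ _ _))

  -- In the explicit sum for `H` at l + 1 + s, the terms with b < l′ + s make up x^(l+1-l′) times
  -- `H` at l′ + s. The others have b = m + s with l′ ≤ m ≤ l, the values open to one part of an
  -- interlacing partition.
  H-reduce : ∀ x ψ s l l′ → l′ ℕ.≤ l →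
             H x ψ (l ℕ.+ suc s) ≈ pow R x (suc l ∸ l′) * H x ψ (l′ ℕ.+ s)
               + ∑≤ l (λ m → ind (l′ ℕ.≤? m) (pow R x (l ∸ m)) * ψ (m ℕ.+ s))
  H-reduce x ψ s zero zero ℕ.z≤n = +-cong (*-congʳ (sym (*-identityʳ x)))
    (sym (trans (∑≤-zero (λ m → ind (0 ℕ.≤? m) (pow R x (0 ∸ m)) * ψ (m ℕ.+ s)))
      (trans (*-congʳ (ind-yes (0 ℕ.≤? 0) ℕ.z≤n)) (*-identityˡ _))))
  H-reduce x ψ s (suc l) l′ h with l′ ℕ.≤? l
  ... | yes l′≤l = begin
    x * H x ψ (l ℕ.+ suc s) + ψ (l ℕ.+ suc s)
      ≈⟨ +-congʳ (*-congˡ (H-reduce x ψ s l l′ l′≤l)) ⟩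
    x * (pow R x (suc l ∸ l′) * h′ + ∑≤ l (λ m → ind (l′ ℕ.≤? m) (pow R x (l ∸ m)) * ψ (m ℕ.+ s))) + ψ (l ℕ.+ suc s)
      ≈⟨ solve 5 (λ x p h t z → x :* (p :* h :+ t) :+ z := (x :* p) :* h :+ (x :* t :+ z)) refl x _ h′ _ _ ⟩
    x * pow R x (suc l ∸ l′) * h′ + (x * ∑≤ l (λ m → ind (l′ ℕ.≤? m) (pow R x (l ∸ m)) * ψ (m ℕ.+ s)) + ψ (l ℕ.+ suc s))
      ≈⟨ +-cong (*-congʳ (reflexive (≡.cong (pow R x) (≡.sym (ℕP.+-∸-assoc 1 h)))))
           (+-cong (trans (∑-*ˡ x _) (∑-cong shift)) top) ⟩
    pow R x (suc (suc l) ∸ l′) * h′ + (∑≤ l term + term (suc l))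
      ≈⟨ +-congˡ (∑≤-last l term) ⟨
    pow R x (suc (suc l) ∸ l′) * h′ + ∑≤ (suc l) term ∎
    where
    h′ : Carrier
    h′ = H x ψ (l′ ℕ.+ s)
    term : ℕ → Carrier
    term m = ind (l′ ℕ.≤? m) (pow R x (suc l ∸ m)) * ψ (m ℕ.+ s)
    shift : ∀ i → x * (ind (l′ ℕ.≤? toℕ i) (pow R x (l ∸ toℕ i)) * ψ (toℕ i ℕ.+ s)) ≈ term (toℕ {suc l} i)
    shift i = trans (sym (*-assoc _ _ _)) (*-congʳ (trans (ind-*ˡ (l′ ℕ.≤? toℕ i) x _)
      (ind-cong (l′ ℕ.≤? toℕ i) (reflexive (≡.cong (pow R x) (≡.sym (ℕP.+-∸-assoc 1 (ℕP.≤-pred (FinP.toℕ<n i)))))))))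
    top : ψ (l ℕ.+ suc s) ≈ term (suc l)
    top = sym (trans (*-congʳ (trans (ind-yes (l′ ℕ.≤? suc l) h) (reflexive (≡.cong (pow R x) (ℕP.n∸n≡0 l)))))
      (trans (*-identityˡ _) (reflexive (≡.cong ψ (≡.sym (ℕP.+-suc l s))))))
  -- Here l′ = l + 1: the power is x itself and only the top term of the sum survives.
  ... | no l′≰l with ℕP.≤-antisym h (ℕP.≰⇒> l′≰l)
  ...   | ≡.refl = begin
    x * H x ψ (l ℕ.+ suc s) + ψ (l ℕ.+ suc s)
      ≈⟨ +-cong (*-cong (sym (*-identityʳ x)) (reflexive (≡.cong (H x ψ) (ℕP.+-suc l s)))) top ⟩
    pow R x 1 * H x ψ (suc l ℕ.+ s) + ∑≤ (suc l) term
      ≈⟨ +-congʳ (*-congʳ (reflexive (≡.cong (pow R x) (≡.sym (ℕP.m+n∸n≡m 1 l))))) ⟩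
    pow R x (suc (suc l) ∸ suc l) * H x ψ (suc l ℕ.+ s) + ∑≤ (suc l) term ∎
    where
    term : ℕ → Carrier
    term m = ind (suc l ℕ.≤? m) (pow R x (suc l ∸ m)) * ψ (m ℕ.+ s)
    top : ψ (l ℕ.+ suc s) ≈ ∑≤ (suc l) term
    top = sym (trans (∑≤-last l term) (trans (+-cong
      (∑-≈0 {suc l} (λ i → trans (*-congʳ (ind-no (suc l ℕ.≤? toℕ i) (ℕP.<⇒≱ (FinP.toℕ<n i)))) (zeroˡ _)))
      (trans (*-congʳ (trans (ind-yes (suc l ℕ.≤? suc l) ℕP.≤-refl) (reflexive (≡.cong (pow R x) (ℕP.n∸n≡0 l)))))
        (trans (*-identityˡ _) (reflexive (≡.cong ψ (≡.sym (ℕP.+-suc l s)))))))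
      (+-identityˡ _)))

  -- A flagged Jacobi-Trudi determinant with its columns reversed: entry (j, p) is the complete
  -- homogeneous polynomial of degree λⱼ + N - 1 - j - p in x₀, ..., xₚ.
  VDet : ∀ {N} → (Fin N → ℕ) → Row N → Carrier
  VDet l x = Det (λ j → V x (l j ℕ.+ co j))

  ∑-onlyLast : ∀ {n} (f : Fin (suc n) → Carrier) → (∀ i → f (inject₁ i) ≈ 0#) → ∑ f ≈ f (lastF n)
  ∑-onlyLast {zero}  f h = trans (∑-suc f) (trans (+-congˡ (∑-zero _)) (+-identityʳ _))
  ∑-onlyLast {suc n} f h = trans (∑-suc f) (trans (+-cong (h zero) (∑-onlyLast (f ∘ suc) (h ∘ suc))) (+-identityˡ _))

  -- The one-variable skew Schur function of λ/μ, up to the factor x^(λ_N) of the last row, which is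
  -- kept outside.
  branchWeight : ∀ {N} → (Fin (suc N) → ℕ) → Carrier → (Fin N → ℕ) → Carrier
  branchWeight l x μ = ∏ (λ a → ind (l (suc a) ℕ.≤? μ a) (pow R x (l (inject₁ a) ∸ μ a)))

  VDet-branch : ∀ {N} (l : Fin (suc N) → ℕ) (x : Row (suc N)) → Descending l →
    VDet l x ≈ sgn R N * (pow R (x zero) (l (lastF N)) *
      ∑Box (l ∘ inject₁) (λ μ → branchWeight l (x zero) μ * VDet μ (x ∘ suc)))
  VDet-branch {N} l x desc = begin
    VDet l x
      -- The exponent is the gap between the exponents of neighbouring rows, so column 0, which
      -- consists of pure powers, is cleared above its last entry.
      ≈⟨ rowReduce Det-IsForm (λ i → - pow R (x zero) (suc (l (inject₁ i)) ∸ l (suc i))) inner outer ⟨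
    Det W
      ≈⟨ Det-col0 W ⟩
    ∑ (λ i → sgn R (toℕ i) * (W i zero * Det (λ a b → W (punchIn i a) (suc b))))
      ≈⟨ ∑-onlyLast _ (λ i → trans (*-congˡ (trans (*-congʳ (reflexive (≡.cong (λ r → r zero) (snocF-inject₁ red _ i)))) (zeroˡ _))) (zeroʳ _)) ⟩
    sgn R (toℕ (lastF N)) * (W (lastF N) zero * Det (λ a b → W (punchIn (lastF N) a) (suc b)))
      ≈⟨ *-cong (reflexive (≡.cong (sgn R) (FinP.toℕ-fromℕ N))) (*-cong
           (reflexive (≡.trans (≡.cong (λ r → r zero) (snocF-last red _))
             (≡.cong (pow R (x zero)) (≡.trans (≡.cong (l (lastF N) ℕ.+_) (co-last N)) (ℕP.+-identityʳ _)))))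
           (Det-cong (λ a b → reflexive (≡.trans (≡.cong (λ i → W i (suc b)) (punchIn-last a))
             (≡.cong (λ r → r (suc b)) (snocF-inject₁ red _ a)))))) ⟩
    sgn R N * (pow R (x zero) (l (lastF N)) * Det (λ a b → ∑≤ (l (inject₁ a)) (λ m → weight a m * V (x ∘ suc) (m ℕ.+ co a) b)))
      -- Row a is a sum over the a-th part alone; multilinearity turns the choices of all rows into
      -- one sum over μ.
      ≈⟨ *-congˡ (*-congˡ (expandRows Det-IsForm (l ∘ inject₁) weight (λ a m → V (x ∘ suc) (m ℕ.+ co a)))) ⟩
    sgn R N * (pow R (x zero) (l (lastF N)) * ∑Box (l ∘ inject₁) (λ μ → branchWeight l (x zero) μ * VDet μ (x ∘ suc))) ∎
    where
    weight : Fin N → ℕ → Carrier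
    weight a m = ind (l (suc a) ℕ.≤? m) (pow R (x zero) (l (inject₁ a) ∸ m))
    red : Rows N (suc N)
    red a = consF 0# (λ b → ∑≤ (l (inject₁ a)) (λ m → weight a m * V (x ∘ suc) (m ℕ.+ co a) b))
    W : Rows (suc N) (suc N)
    W = snocF red (V x (l (lastF N) ℕ.+ co (lastF N)))
    cancel : ∀ {u p h t} → u ≈ p * h + t → t ≈ (- p) * h + u
    cancel {u} {p} {h} {t} e = sym (begin
      (- p) * h + u              ≈⟨ +-congˡ e ⟩
      (- p) * h + (p * h + t)    ≈⟨ solve 4 (λ m h p t → m :* h :+ (p :* h :+ t) := (m :+ p) :* h :+ t) refl _ _ _ _ ⟩
      (- p + p) * h + t          ≈⟨ +-congʳ (trans (*-congʳ (-‿inverseˡ p)) (zeroˡ h)) ⟩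
      0# + t                     ≈⟨ +-identityˡ t ⟩
      t                          ∎)
    exponent : ∀ i → l (inject₁ i) ℕ.+ suc (co i) ≡ (suc (l (inject₁ i)) ∸ l (suc i)) ℕ.+ (l (suc i) ℕ.+ co i)
    exponent i = ≡.trans (ℕP.+-suc _ _) (≡.trans (≡.cong (ℕ._+ co i)
      (≡.sym (ℕP.m∸n+n≡m (ℕP.m≤n⇒m≤1+n (desc i))))) (ℕP.+-assoc (suc (l (inject₁ i)) ∸ l (suc i)) (l (suc i)) (co i)))
    entry : ∀ i → red i ≐ (λ p → (- pow R (x zero) (suc (l (inject₁ i)) ∸ l (suc i))) * V x (l (suc i) ℕ.+ co i) p
                            + V x (l (inject₁ i) ℕ.+ suc (co i)) p)
    entry i zero = cancel (trans (trans (reflexive (≡.cong (pow R (x zero)) (exponent i)))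
      (pow-+ (x zero) (suc (l (inject₁ i)) ∸ l (suc i)) _)) (sym (+-identityʳ _)))
    entry i (suc b) = cancel (H-reduce (x zero) (λ e → V (x ∘ suc) e b) (co i) (l (inject₁ i)) (l (suc i)) (desc i))
    inner : ∀ i → W (inject₁ i) ≐ (λ p → (- pow R (x zero) (suc (l (inject₁ i)) ∸ l (suc i))) * V x (l (suc i) ℕ.+ co (suc i)) p
                            + V x (l (inject₁ i) ℕ.+ co (inject₁ i)) p)
    inner i p = trans (reflexive (≡.cong (λ r → r p) (snocF-inject₁ red _ i)))
      (trans (entry i p) (+-congˡ (reflexive (≡.cong (λ e → V x (l (inject₁ i) ℕ.+ e) p) (≡.sym (co-inject₁ i))))))
    outer : W (lastF N) ≐ V x (l (lastF N) ℕ.+ co (lastF N))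
    outer p = reflexive (≡.cong (λ r → r p) (snocF-last red _))

  -- Branching of tableaux along the largest letter

  ind-⇔ : ∀ {a b} {P : Set a} {Q : Set b} (d : Dec P) (e : Dec Q) {z z′} →
          (P → Q) → (Q → P) → z ≈ z′ → ind d z ≈ ind e z′
  ind-⇔ (yes p) e to from h = trans h (sym (ind-yes e (to p)))
  ind-⇔ (no ¬p) e to from h = sym (ind-no e (λ q → ¬p (from q)))

  ind-× : ∀ {a b b′} {P : Set a} {Q : Set b} {S : Set b′} (d : Dec P) (e : Dec Q) (f : Dec S) z →
          (P → Q × S) → (Q × S → P) → ind d z ≈ ind e (ind f z)
  ind-× d (yes q) f z to from = ind-⇔ d f (λ p → proj₂ (to p)) (λ s → from (q , s)) refl
  ind-× d (no ¬q) f z to from = ind-no d (λ p → ¬q (proj₁ (to p)))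

  ind-∑ : ∀ {a k} {P : Set a} (d : Dec P) (f : Fin k → Carrier) → ind d (∑ f) ≈ ∑ (λ i → ind d (f i))
  ind-∑ (yes _) f = refl
  ind-∑ (no _)  f = sym (∑-≈0 (λ i → refl))

  -- From list sums to iterated sums over rows and fillings

  ΣL-++ : ∀ xs ys → ΣL R (xs List.++ ys) ≈ ΣL R xs + ΣL R ys
  ΣL-++ []       ys = sym (+-identityˡ _)
  ΣL-++ (x ∷ xs) ys = trans (+-congˡ (ΣL-++ xs ys)) (sym (+-assoc _ _ _))

  ΣL-cong : ∀ {a} {A : Set a} {f g : A → Carrier} → (∀ x → f x ≈ g x) → ∀ xs →
            ΣL R (List.map f xs) ≈ ΣL R (List.map g xs)
  ΣL-cong h []       = refl
  ΣL-cong h (x ∷ xs) = +-cong (h x) (ΣL-cong h xs)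

  ΣL-map : ∀ {a b} {A : Set a} {B : Set b} (f : B → Carrier) (g : A → B) xs →
           ΣL R (List.map f (List.map g xs)) ≈ ΣL R (List.map (λ x → f (g x)) xs)
  ΣL-map f g []       = refl
  ΣL-map f g (x ∷ xs) = +-congˡ (ΣL-map f g xs)

  ΣL-concatMap : ∀ {a b} {A : Set a} {B : Set b} (f : B → Carrier) (g : A → List B) xs →
                 ΣL R (List.map f (List.concatMap g xs)) ≈ ΣL R (List.map (λ x → ΣL R (List.map f (g x))) xs)
  ΣL-concatMap f g []       = refl
  ΣL-concatMap f g (x ∷ xs) = trans
    (reflexive (≡.cong (ΣL R) (ListP.map-++ f (g x) (List.concatMap g xs))))
    (trans (ΣL-++ (List.map f (g x)) _) (+-congˡ (ΣL-concatMap f g xs)))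

  ΣL-tabulate : ∀ {a} {A : Set a} {k} (f : A → Carrier) (g : Fin k → A) →
                ΣL R (List.map f (List.tabulate g)) ≈ ∑ (λ i → f (g i))
  ΣL-tabulate {k = zero}  f g = sym (∑-zero _)
  ΣL-tabulate {k = suc k} f g = trans (+-congˡ (ΣL-tabulate f (g ∘ suc))) (sym (∑-suc _))

  ΣL-ind : ∀ {a b} {A : Set a} {P : Set b} (d : Dec P) (f : A → Carrier) xs →
           ΣL R (List.map (λ x → ind d (f x)) xs) ≈ ind d (ΣL R (List.map f xs))
  ΣL-ind (yes _) f xs       = refl
  ΣL-ind (no _)  f []       = refl
  ΣL-ind (no ¬p) f (x ∷ xs) = trans (+-identityˡ _) (ΣL-ind (no ¬p) f xs)

  ΣL-filter : ∀ {a b} {A : Set a} {P : A → Set b} (P? : ∀ x → Dec (P x)) (f : A → Carrier) xs →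
              ΣL R (List.map f (List.filter P? xs)) ≈ ΣL R (List.map (λ x → ind (P? x) (f x)) xs)
  ΣL-filter P? f [] = refl
  ΣL-filter P? f (x ∷ xs) with P? x
  ... | yes _ = +-congˡ (ΣL-filter P? f xs)
  ... | no _  = trans (ΣL-filter P? f xs) (sym (+-identityˡ _))

  -- Rows are functions, and regrouping a sum reproduces them only pointwise; summands must respect
  -- that.
  RowExt : ∀ {N k} → ((Fin k → Fin N) → Carrier) → Set ℓ
  RowExt f = ∀ {r r′} → (∀ c → r c ≡ r′ c) → f r ≈ f r′

  -- Sums over weakly increasing rows only: each letter has to bound the rest of its row from below.
  ∑Row : ∀ N k → ((Fin k → Fin N) → Carrier) → Carrier
  ∑Row N zero    f = f (λ ())
  ∑Row N (suc k) f = ∑ {N} (λ a → ∑Row N k (λ r → ind (lowerBound? a r) (f (consF a r))))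

  consF-≗ : ∀ {N k} (a : Fin N) {r r′ : Fin k → Fin N} → (∀ c → r c ≡ r′ c) → ∀ c → consF a r c ≡ consF a r′ c
  consF-≗ a h zero    = ≡.refl
  consF-≗ a h (suc c) = h c

  LowerBound-resp : ∀ {N k} {a : Fin N} {r r′ : Fin k → Fin N} → (∀ c → r c ≡ r′ c) → LowerBound a r → LowerBound a r′
  LowerBound-resp {a = a} h b c = ≡.subst (a Fin.≤_) (h c) (b c)

  RowExt-consF : ∀ {N k} {f : (Fin (suc k) → Fin N) → Carrier} → RowExt f → ∀ a →
                 RowExt (λ r → ind (lowerBound? a r) (f (consF a r)))
  RowExt-consF f≈ a {r} {r′} h = ind-⇔ (lowerBound? a r) (lowerBound? a r′)
    (LowerBound-resp h) (LowerBound-resp (λ c → ≡.sym (h c))) (f≈ (consF-≗ a h))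

  ∑Row-cong : ∀ N k {f g : (Fin k → Fin N) → Carrier} → (∀ r → f r ≈ g r) → ∑Row N k f ≈ ∑Row N k g
  ∑Row-cong N zero    h = h _
  ∑Row-cong N (suc k) h = ∑-cong (λ a → ∑Row-cong N k (λ r → ind-cong (lowerBound? a r) (h _)))

  ∑Row-≈0 : ∀ N k {f : (Fin k → Fin N) → Carrier} → (∀ r → f r ≈ 0#) → ∑Row N k f ≈ 0#
  ∑Row-≈0 N zero    h = h _
  ∑Row-≈0 N (suc k) h = ∑-≈0 (λ a → ∑Row-≈0 N k (λ r → trans (ind-cong (lowerBound? a r) (h _)) (ind-0 (lowerBound? a r))))
    where
    ind-0 : ∀ {a} {P : Set a} (d : Dec P) → ind d 0# ≈ 0#
    ind-0 (yes _) = refl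
    ind-0 (no _)  = refl

  ∑Row-∑ : ∀ N k {n} (f : (Fin k → Fin N) → Fin n → Carrier) →
           ∑Row N k (λ r → ∑ (f r)) ≈ ∑ (λ i → ∑Row N k (λ r → f r i))
  ∑Row-∑ N zero    f = refl
  ∑Row-∑ N (suc k) f = trans (∑-cong (λ a → trans
      (∑Row-cong N k (λ r → ind-∑ (lowerBound? a r) (f (consF a r))))
      (∑Row-∑ N k (λ r i → ind (lowerBound? a r) (f (consF a r) i)))))
    (∑-swap _)

  ∑Row-*ˡ : ∀ N k b (f : (Fin k → Fin N) → Carrier) → b * ∑Row N k f ≈ ∑Row N k (λ r → b * f r)
  ∑Row-*ˡ N zero    b f = refl
  ∑Row-*ˡ N (suc k) b f = trans (∑-*ˡ b _) (∑-cong (λ a → trans (∑Row-*ˡ N k b _)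
    (∑Row-cong N k (λ r → ind-*ˡ (lowerBound? a r) b _))))

  ΣL-allFuns : ∀ N k {f : (Fin k → Fin N) → Carrier} → RowExt f →
               ΣL R (List.map (λ r → ind (weaklyIncreasing? r) (f r)) (allFuns N k)) ≈ ∑Row N k f
  ΣL-allFuns N zero {f} f≈ = empty _
    where
    empty : ∀ r → ind (weaklyIncreasing? r) (f r) + 0# ≈ ∑Row N 0 f
    empty r = trans (+-identityʳ _) (trans (ind-yes (weaklyIncreasing? r) (λ ())) (f≈ (λ ())))
  ΣL-allFuns N (suc k) {f} f≈ = begin
    ΣL R (List.map g (List.concatMap (λ a → List.map (consF a) (allFuns N k)) (List.allFin N)))
      ≈⟨ ΣL-concatMap g _ (List.allFin N) ⟩
    ΣL R (List.map (λ a → ΣL R (List.map g (List.map (consF a) (allFuns N k)))) (List.allFin N))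
      ≈⟨ ΣL-tabulate {k = N} _ (λ a → a) ⟩
    ∑ (λ a → ΣL R (List.map g (List.map (consF a) (allFuns N k))))
      ≈⟨ ∑-cong (λ a → trans (ΣL-map g (consF a) (allFuns N k)) (trans (ΣL-cong (λ r →
           ind-× (weaklyIncreasing? (consF a r)) (weaklyIncreasing? r) (lowerBound? a r) _
             (WeaklyIncreasing-consF a r) (consF-WeaklyIncreasing a r)) (allFuns N k))
           (ΣL-allFuns N k (RowExt-consF f≈ a)))) ⟩
    ∑Row N (suc k) f ∎
    where
    g : (Fin (suc k) → Fin N) → Carrier
    g r = ind (weaklyIncreasing? r) (f r)

  ∑-last : ∀ {n} (f : Fin (suc n) → Carrier) → ∑ f ≈ ∑ (λ i → f (inject₁ i)) + f (lastF n)
  ∑-last {zero}  f = trans (∑-suc f) (trans (+-comm _ _) (+-congʳ (trans (∑-zero _) (sym (∑-zero _)))))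
  ∑-last {suc n} f = trans (∑-suc f) (trans (+-congˡ (∑-last (f ∘ suc)))
    (trans (sym (+-assoc _ _ _)) (+-congʳ (sym (∑-suc _)))))

  ∑≤-onlyZero : ∀ l f → (∀ m → m ℕ.< l → f (suc m) ≈ 0#) → ∑≤ l f ≈ f 0
  ∑≤-onlyZero zero    f h = ∑≤-zero f
  ∑≤-onlyZero (suc l) f h = trans (∑≤-suc l f)
    (trans (+-congˡ (∑-≈0 {suc l} (λ i → h (toℕ i) (FinP.toℕ<n i)))) (+-identityʳ _))

  -- Induction through the first letter. A smaller first letter raises the number m of smaller
  -- letters by one. A largest first letter forces a constant row, so only m = 0 survives in the
  -- remaining sum.
  ∑Row-branch : ∀ N l {f : (Fin l → Fin (suc N)) → Carrier} → RowExt f →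
                ∑Row (suc N) l f ≈ ∑≤ l (λ m → ∑Row N m (λ r → f (extend l m r)))
  ∑Row-branch N zero {f} f≈ = sym (trans (∑≤-zero (λ m → ∑Row N m (λ r → f (extend 0 m r)))) (f≈ (λ ())))
  ∑Row-branch N (suc l) {f} f≈ = begin
    ∑ (λ a → ∑Row (suc N) l (g a))
      ≈⟨ ∑-last _ ⟩
    ∑ (λ a → ∑Row (suc N) l (g (inject₁ a))) + ∑Row (suc N) l (g (lastF N))
      ≈⟨ +-cong (∑-cong (λ a → ∑Row-branch N l (RowExt-consF f≈ (inject₁ a)))) (∑Row-branch N l (RowExt-consF f≈ (lastF N))) ⟩
    ∑ (λ a → ∑≤ l (λ m → ∑Row N m (λ r → g (inject₁ a) (extend l m r)))) + ∑≤ l (λ m → ∑Row N m (λ r → g (lastF N) (extend l m r)))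
      ≈⟨ +-cong (trans (∑-swap _) (∑-cong smaller)) (trans (∑≤-onlyZero l (λ m → ∑Row N m (λ r → g (lastF N) (extend l m r))) largest) constant) ⟩
    ∑≤ l (λ m → ∑Row N (suc m) (λ r → f (extend (suc l) (suc m) r))) + f (extend (suc l) 0 (λ ()))
      ≈⟨ +-comm _ _ ⟩
    f (extend (suc l) 0 (λ ())) + ∑≤ l (λ m → ∑Row N (suc m) (λ r → f (extend (suc l) (suc m) r)))
      ≈⟨ ∑≤-suc l (λ m → ∑Row N m (λ r → f (extend (suc l) m r))) ⟨
    ∑≤ (suc l) (λ m → ∑Row N m (λ r → f (extend (suc l) m r))) ∎
    where
    g : Fin (suc N) → (Fin l → Fin (suc N)) → Carrier
    g a r = ind (lowerBound? a r) (f (consF a r))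
    smaller : ∀ (i : Fin (suc l)) → ∑ (λ a → ∑Row N (toℕ i) (λ r → g (inject₁ a) (extend l (toℕ i) r)))
              ≈ ∑Row N (suc (toℕ i)) (λ r → f (extend (suc l) (suc (toℕ i)) r))
    smaller i = ∑-cong (λ a → ∑Row-cong N m (λ r →
      ind-⇔ (lowerBound? (inject₁ a) (extend l m r)) (lowerBound? a r)
        (extend-LowerBound a l m r (ℕP.≤-pred (FinP.toℕ<n i))) (LowerBound-extend a l m r)
        (f≈ (λ { zero → ≡.refl ; (suc c) → ≡.refl }))))
      where
      m : ℕ
      m = toℕ i
    largest : ∀ m → m ℕ.< l → ∑Row N (suc m) (λ r → g (lastF N) (extend l (suc m) r)) ≈ 0#
    largest m (ℕ.s≤s _) = ∑Row-≈0 N (suc m) {λ r → g (lastF N) (extend l (suc m) r)}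
      (λ r → ind-no (lowerBound? (lastF N) (extend l (suc m) r)) (λ b → last-≰ (r zero) (b zero)))
    constant : g (lastF N) (extend l 0 (λ ())) ≈ f (extend (suc l) 0 (λ ()))
    constant = trans (ind-yes (lowerBound? (lastF N) (extend {N} l 0 (λ ()))) (λ c → ℕP.≤-refl))
      (f≈ (λ { zero → ≡.refl ; (suc c) → ≡.refl }))

  ∑Row-constant : ∀ N l {f : (Fin l → Fin (suc N)) → Carrier} → RowExt f →
                  (∀ r c → r c ≢ lastF N → f r ≈ 0#) → ∑Row (suc N) l f ≈ f (λ _ → lastF N)
  ∑Row-constant N l {f} f≈ h = trans (∑Row-branch N l f≈) (trans
    (∑≤-onlyZero l (λ m → ∑Row N m (λ r → f (extend l m r)))
      (λ { m (ℕ.s≤s _) → ∑Row-≈0 N (suc m) {λ r → f (extend l (suc m) r)}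
        (λ r → h (extend l (suc m) r) zero (FinP.fromℕ≢inject₁ ∘ ≡.sym)) }))
    (f≈ (λ c → ≡.refl)))

  FillExt : ∀ {N m} {sh : Fin m → ℕ} → (Fill N sh → Carrier) → Set ℓ
  FillExt f = ∀ {T T′} → T ≗₂ T′ → f T ≈ f T′

  ∑Fill : ∀ N {m} (sh : Fin m → ℕ) → (Fill N sh → Carrier) → Carrier
  ∑Fill N {zero}  sh f = f (λ ())
  ∑Fill N {suc m} sh f = ∑Row N (sh zero) (λ r → ∑Fill N (sh ∘ suc) (λ T → f (consRow {sh = sh} r T)))

  ∑Fill-cong : ∀ N {m} (sh : Fin m → ℕ) {f g : Fill N sh → Carrier} → (∀ T → f T ≈ g T) →
               ∑Fill N sh f ≈ ∑Fill N sh g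
  ∑Fill-cong N {zero}  sh h = h _
  ∑Fill-cong N {suc m} sh h = ∑Row-cong N (sh zero) (λ r → ∑Fill-cong N (sh ∘ suc) (λ T → h _))

  ∑Fill-*ˡ : ∀ N {m} (sh : Fin m → ℕ) b (f : Fill N sh → Carrier) → b * ∑Fill N sh f ≈ ∑Fill N sh (λ T → b * f T)
  ∑Fill-*ˡ N {zero}  sh b f = refl
  ∑Fill-*ˡ N {suc m} sh b f = trans (∑Row-*ˡ N (sh zero) b _) (∑Row-cong N (sh zero) (λ r → ∑Fill-*ˡ N (sh ∘ suc) b _))

  FillExt-consRow : ∀ {N m} {sh : Fin (suc m) → ℕ} {f : Fill N sh → Carrier} → FillExt f → ∀ r →
                    FillExt (λ T → f (consRow {sh = sh} r T))
  FillExt-consRow {sh = sh} f≈ r h = f≈ (consRow-cong {sh = sh} (λ _ → ≡.refl) h)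

  RowExt-∑Fill : ∀ {N m} {sh : Fin (suc m) → ℕ} {f : Fill N sh → Carrier} → FillExt f →
                 RowExt (λ r → ∑Fill N (sh ∘ suc) (λ T → f (consRow {sh = sh} r T)))
  RowExt-∑Fill {N} {sh = sh} f≈ h = ∑Fill-cong N (sh ∘ suc) (λ T → f≈ (consRow-cong {sh = sh} h (λ _ _ → ≡.refl)))

  ΣL-allFillings : ∀ N m (sh : Fin m → ℕ) {f : Fill N sh → Carrier} → FillExt f →
                   ΣL R (List.map (λ T → ind (rowsIncreasing? sh T) (f T)) (allFillings N m sh)) ≈ ∑Fill N sh f
  ΣL-allFillings N zero sh {f} f≈ = empty _
    where
    empty : ∀ T → ind (rowsIncreasing? sh T) (f T) + 0# ≈ ∑Fill N sh f
    empty T = trans (+-identityʳ _) (trans (ind-yes (rowsIncreasing? sh T) (λ ())) (f≈ (λ ())))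
  ΣL-allFillings N (suc m) sh {f} f≈ = begin
    ΣL R (List.map g (List.concatMap (λ r → List.map (cons r) (allFillings N m (sh ∘ suc))) (allFuns N (sh zero))))
      ≈⟨ ΣL-concatMap g _ (allFuns N (sh zero)) ⟩
    ΣL R (List.map (λ r → ΣL R (List.map g (List.map (cons r) (allFillings N m (sh ∘ suc))))) (allFuns N (sh zero)))
      ≈⟨ ΣL-cong row (allFuns N (sh zero)) ⟩
    ΣL R (List.map (λ r → ind (weaklyIncreasing? r) (∑Fill N (sh ∘ suc) (λ T → f (cons r T)))) (allFuns N (sh zero)))
      ≈⟨ ΣL-allFuns N (sh zero) (RowExt-∑Fill {sh = sh} f≈) ⟩
    ∑Fill N sh f ∎
    where
    cons : (Fin (sh zero) → Fin N) → Fill N (sh ∘ suc) → Fill N sh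
    cons r T = consRow {sh = sh} r T
    g : Fill N sh → Carrier
    g T = ind (rowsIncreasing? sh T) (f T)
    row : ∀ r → ΣL R (List.map g (List.map (cons r) (allFillings N m (sh ∘ suc))))
          ≈ ind (weaklyIncreasing? r) (∑Fill N (sh ∘ suc) (λ T → f (cons r T)))
    row r = begin
      ΣL R (List.map g (List.map (cons r) (allFillings N m (sh ∘ suc))))
        ≈⟨ ΣL-map g (cons r) (allFillings N m (sh ∘ suc)) ⟩
      ΣL R (List.map (λ T → g (cons r T)) (allFillings N m (sh ∘ suc)))
        ≈⟨ ΣL-cong (λ T → ind-× (rowsIncreasing? sh (cons r T)) (weaklyIncreasing? r) (rowsIncreasing? (sh ∘ suc) T) _
             (λ w → w zero , (λ i → w (suc i))) (λ { (w , ws) zero → w ; (w , ws) (suc i) → ws i })) (allFillings N m (sh ∘ suc)) ⟩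
      ΣL R (List.map (λ T → ind (weaklyIncreasing? r) (ind (rowsIncreasing? (sh ∘ suc) T) (f (cons r T)))) (allFillings N m (sh ∘ suc)))
        ≈⟨ ΣL-ind (weaklyIncreasing? r) _ (allFillings N m (sh ∘ suc)) ⟩
      ind (weaklyIncreasing? r) (ΣL R (List.map (λ T → ind (rowsIncreasing? (sh ∘ suc) T) (f (cons r T))) (allFillings N m (sh ∘ suc))))
        ≈⟨ ind-cong (weaklyIncreasing? r) (ΣL-allFillings N m (sh ∘ suc) (FillExt-consRow {sh = sh} f≈ r)) ⟩
      ind (weaklyIncreasing? r) (∑Fill N (sh ∘ suc) (λ T → f (cons r T))) ∎

  ∑Row-∑Box : ∀ N k {m} (l : Fin m → ℕ) (f : (Fin k → Fin N) → (Fin m → ℕ) → Carrier) →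
              ∑Row N k (λ r → ∑Box l (f r)) ≈ ∑Box l (λ μ → ∑Row N k (λ r → f r μ))
  ∑Row-∑Box N k {zero}  l f = refl
  ∑Row-∑Box N k {suc m} l f = trans (∑Row-∑ N k _) (∑-cong (λ t → ∑Row-∑Box N k (l ∘ suc) _))

  ∑Fill-branch : ∀ N {m} (sh : Fin m → ℕ) {f : Fill (suc N) sh → Carrier} → FillExt f →
                 ∑Fill (suc N) sh f ≈ ∑Box sh (λ μ → ∑Fill N μ (λ T → f (extendFill sh μ T)))
  ∑Fill-branch N {zero}  sh f≈ = f≈ (λ ())
  ∑Fill-branch N {suc m} sh {f} f≈ = begin
    ∑Row (suc N) (sh zero) (λ r → ∑Fill (suc N) (sh ∘ suc) (λ T → f (consRow {sh = sh} r T)))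
      ≈⟨ ∑Row-branch N (sh zero) (RowExt-∑Fill {sh = sh} f≈) ⟩
    ∑≤ (sh zero) (λ t → ∑Row N t (λ r → ∑Fill (suc N) (sh ∘ suc) (λ T → f (consRow {sh = sh} (extend (sh zero) t r) T))))
      ≈⟨ ∑-cong {suc (sh zero)} (λ i → ∑Row-cong N (toℕ i) (λ r → ∑Fill-branch N (sh ∘ suc)
           (FillExt-consRow {sh = sh} f≈ (extend (sh zero) (toℕ i) r)))) ⟩
    ∑≤ (sh zero) (λ t → ∑Row N t (λ r → ∑Box (sh ∘ suc) (λ μ → ∑Fill N μ (λ T →
      f (consRow {sh = sh} (extend (sh zero) t r) (extendFill (sh ∘ suc) μ T))))))
      ≈⟨ ∑-cong {suc (sh zero)} (λ i → ∑Row-∑Box N (toℕ i) (sh ∘ suc) _) ⟩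
    ∑≤ (sh zero) (λ t → ∑Box (sh ∘ suc) (λ μ → ∑Row N t (λ r → ∑Fill N μ (λ T →
      f (consRow {sh = sh} (extend (sh zero) t r) (extendFill (sh ∘ suc) μ T))))))
      ≈⟨ ∑-cong {suc (sh zero)} (λ i → ∑Box-cong (sh ∘ suc) (λ μ → ∑Row-cong N (toℕ i) (λ r → ∑Fill-cong N μ (λ T →
           f≈ (λ { zero c → ≡.refl ; (suc j) c → ≡.refl }))))) ⟩
    ∑Box sh (λ μ → ∑Fill N μ (λ T → f (extendFill sh μ T))) ∎

  -- `∑Fill` takes row 0 outermost; this form isolates the last row, whose content column strictness
  -- forces.
  ∑Fill-snoc : ∀ N {m} (sh : Fin (suc m) → ℕ) {f : Fill N sh → Carrier} → FillExt f →
               ∑Fill N sh f ≈ ∑Fill N (sh ∘ inject₁) (λ T → ∑Row N (sh (lastF m)) (λ r → f (snocRow {sh = sh} T r)))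
  ∑Fill-snoc N {zero}  sh f≈ = ∑Row-cong N (sh zero) (λ r → f≈ (λ { zero c → ≡.refl }))
  ∑Fill-snoc N {suc m} sh {f} f≈ = ∑Row-cong N (sh zero) (λ r → trans
    (∑Fill-snoc N (sh ∘ suc) (FillExt-consRow {sh = sh} f≈ r))
    (∑Fill-cong N (λ i → sh (suc (inject₁ i))) (λ T → ∑Row-cong N (sh (lastF (suc m))) (λ s →
      f≈ (λ { zero c → ≡.refl ; (suc i) c → ≡.refl })))))

  -- The Schur polynomial as a tableau sum and its branching rule

  weight : ∀ {N m} (sh : Fin m → ℕ) → Row N → Fill N sh → Carrier
  weight sh z T = ∏ (λ i → ∏ (λ c → z (T i c)))

  ∑SSYT : ∀ N {m} → (Fin m → ℕ) → Row N → Carrier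
  ∑SSYT N sh z = ∑Fill N sh (λ T → ind (columnStrict? sh T) (weight sh z T))

  weight-ext : ∀ {N m} (sh : Fin m → ℕ) (z : Row N) → FillExt (weight sh z)
  weight-ext sh z h = ∏-cong (λ i → ∏-cong (λ c → reflexive (≡.cong z (h i c))))

  summand-ext : ∀ {N m} (sh : Fin m → ℕ) (z : Row N) →
                FillExt (λ T → ind (columnStrict? sh T) (weight sh z T))
  summand-ext sh z {T} {T′} h = ind-⇔ (columnStrict? sh T) (columnStrict? sh T′)
    (ColumnStrict-resp h) (ColumnStrict-resp (λ i c → ≡.sym (h i c))) (weight-ext sh z h)

  monomial≈weight : ∀ {N} {sh : Fin N → ℕ} z (T : Fill N sh) → monomial R z T ≈ weight sh z T
  monomial≈weight z T = trans (sym (reflexive (∏-def _))) (∏-cong (λ i → sym (reflexive (∏-def _))))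

  schur≈∑SSYT : ∀ N (l : Fin N → ℕ) z → schur R N l z ≈ ∑SSYT N l z
  schur≈∑SSYT N l z = begin
    ΣL R (List.map (monomial R z) (List.filter (isSSYT? N l) (allFillings N N l)))
      ≈⟨ ΣL-filter (isSSYT? N l) (monomial R z) (allFillings N N l) ⟩
    ΣL R (List.map (λ T → ind (isSSYT? N l T) (monomial R z T)) (allFillings N N l))
      ≈⟨ ΣL-cong (λ T → trans
           (ind-× (isSSYT? N l T) (rowsIncreasing? l T) (columnStrict? l T) _ (λ p → p) (λ p → p))
           (ind-cong (rowsIncreasing? l T) (ind-cong (columnStrict? l T) (monomial≈weight z T)))) (allFillings N N l) ⟩
    ΣL R (List.map (λ T → ind (rowsIncreasing? l T) (ind (columnStrict? l T) (weight l z T))) (allFillings N N l))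
      ≈⟨ ΣL-allFillings N N l (summand-ext l z) ⟩
    ∑SSYT N l z ∎

  ∏-last : ∀ {n} (f : Fin (suc n) → Carrier) → ∏ f ≈ ∏ (λ i → f (inject₁ i)) * f (lastF n)
  ∏-last {zero}  f = trans (∏-suc f) (trans (*-comm _ _) (*-congʳ (trans (∏-zero _) (sym (∏-zero _)))))
  ∏-last {suc n} f = trans (∏-suc f) (trans (*-congˡ (∏-last (f ∘ suc)))
    (trans (sym (*-assoc _ _ _)) (*-congʳ (sym (∏-suc _)))))

  ∏-const : ∀ n x → ∏ {n} (λ _ → x) ≈ pow R x n
  ∏-const zero    x = ∏-zero _
  ∏-const (suc n) x = trans (∏-suc _) (*-congˡ (∏-const n x))

  ∏-≈0 : ∀ {n} (f : Fin n → Carrier) i → f i ≈ 0# → ∏ f ≈ 0#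
  ∏-≈0 f zero    h = trans (∏-suc f) (trans (*-congʳ h) (zeroˡ _))
  ∏-≈0 f (suc i) h = trans (∏-suc f) (trans (*-congˡ (∏-≈0 (f ∘ suc) i h)) (zeroʳ _))

  ∏-extend : ∀ {N} (z : Row (suc N)) l m (r : Fin m → Fin N) → m ℕ.≤ l →
             ∏ (λ c → z (extend l m r c)) ≈ pow R (z (lastF N)) (l ∸ m) * ∏ (λ c → z (inject₁ (r c)))
  ∏-extend z l zero r h = trans (∏-const l _) (sym (trans (*-congˡ (∏-zero _)) (*-identityʳ _)))
  ∏-extend z (suc l) (suc m) r h = begin
    ∏ (λ c → z (extend (suc l) (suc m) r c))
      ≈⟨ ∏-suc _ ⟩
    z (inject₁ (r zero)) * ∏ (λ c → z (extend l m (r ∘ suc) c))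
      ≈⟨ *-congˡ (∏-extend z l m (r ∘ suc) (ℕP.≤-pred h)) ⟩
    z (inject₁ (r zero)) * (p * ∏ (λ c → z (inject₁ (r (suc c)))))
      ≈⟨ solve 3 (λ a b d → a :* (b :* d) := b :* (a :* d)) refl _ _ _ ⟩
    p * (z (inject₁ (r zero)) * ∏ (λ c → z (inject₁ (r (suc c)))))
      ≈⟨ *-congˡ (∏-suc _) ⟨
    p * ∏ (λ c → z (inject₁ (r c))) ∎
    where
    p : Carrier
    p = pow R (z (lastF _)) (l ∸ m)

  weight-completed : ∀ {N} (l : Fin (suc N) → ℕ) part (z : Row (suc N)) μ (μ≤l : ∀ i → μ i ℕ.≤ l (inject₁ i)) T →
    weight l z (completed l part μ μ≤l T) ≈
    pow R (z (lastF N)) (l (lastF N)) *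
      (∏ (λ a → pow R (z (lastF N)) (l (inject₁ a) ∸ μ a)) * weight μ (z ∘ inject₁) T)
  weight-completed {N} l part z μ μ≤l T = begin
    weight l z T⁺
      ≈⟨ ∏-last _ ⟩
    ∏ (λ a → ∏ (λ c → z (T⁺ (inject₁ a) c))) * ∏ (λ c → z (T⁺ (lastF N) c))
      ≈⟨ *-cong (∏-cong (λ a → trans
             (∏-cong (λ c → reflexive (≡.cong z (snocRow-inject₁ {sh = l} _ _ a c))))
             (∏-extend z (l (inject₁ a)) (μ a) (T a) (μ≤l a))))
           (trans (∏-cong (λ c → reflexive (≡.cong z (snocRow-last {sh = l} _ _ c)))) (∏-const (l (lastF N)) _)) ⟩
    ∏ (λ a → pow R (z (lastF N)) (l (inject₁ a) ∸ μ a) * ∏ (λ c → z (inject₁ (T a c)))) * pow R (z (lastF N)) (l (lastF N))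
      ≈⟨ *-comm _ _ ⟩
    pow R (z (lastF N)) (l (lastF N)) * ∏ (λ a → pow R (z (lastF N)) (l (inject₁ a) ∸ μ a) * ∏ (λ c → z (inject₁ (T a c))))
      ≈⟨ *-congˡ (∏-* _ _) ⟩
    pow R (z (lastF N)) (l (lastF N)) *
      (∏ (λ a → pow R (z (lastF N)) (l (inject₁ a) ∸ μ a)) * weight μ (z ∘ inject₁) T) ∎
    where
    T⁺ : Fill (suc N) l
    T⁺ = completed l part μ μ≤l T

  interlaces? : ∀ {N} (l : Fin (suc N) → ℕ) (μ : Fin N → ℕ) → Dec (Interlaces l μ)
  interlaces? l μ = FinP.all? (λ a → l (suc a) ℕ.≤? μ a)

  branchWeight-yes : ∀ {N} (l : Fin (suc N) → ℕ) x (μ : Fin N → ℕ) → Interlaces l μ →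
                     branchWeight l x μ ≈ ∏ (λ a → pow R x (l (inject₁ a) ∸ μ a))
  branchWeight-yes l x μ p = ∏-cong (λ a → ind-yes (l (suc a) ℕ.≤? μ a) (p a))

  branchWeight-no : ∀ {N} (l : Fin (suc N) → ℕ) x (μ : Fin N → ℕ) → ¬ Interlaces l μ →
                    branchWeight l x μ ≈ 0#
  branchWeight-no l x μ ¬p with FinP.¬∀⟶∃¬ _ _ (λ a → l (suc a) ℕ.≤? μ a) ¬p
  ... | a , ¬q = ∏-≈0 _ a (ind-no (l (suc a) ℕ.≤? μ a) ¬q)

  -- The last row is constant, and in the other rows the smaller letters occupy a shape μ. For a
  -- non-interlacing μ both sides vanish: no completed filling is column strict, and the branch
  -- weight has a zero factor.
  ∑SSYT-branch : ∀ {N} (l : Fin (suc N) → ℕ) → IsPartition (suc N) l → ∀ z →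
    ∑SSYT (suc N) l z ≈ pow R (z (lastF N)) (l (lastF N)) *
      ∑Box (l ∘ inject₁) (λ μ → branchWeight l (z (lastF N)) μ * ∑SSYT N μ (z ∘ inject₁))
  ∑SSYT-branch {N} l part z = begin
    ∑Fill (suc N) l f
      ≈⟨ ∑Fill-snoc (suc N) l f≈ ⟩
    ∑Fill (suc N) (l ∘ inject₁) (λ T → ∑Row (suc N) (l (lastF N)) (λ r → f (snocRow {sh = l} T r)))
      ≈⟨ ∑Fill-cong (suc N) (l ∘ inject₁) (λ T → ∑Row-constant N (l (lastF N))
           (λ h → f≈ (snocRow-cong {sh = l} (λ _ _ → ≡.refl) h)) (lastRow T)) ⟩
    ∑Fill (suc N) (l ∘ inject₁) (λ T → f (snocRow {sh = l} T (λ _ → lastF N)))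
      ≈⟨ ∑Fill-branch N (l ∘ inject₁) (λ h → f≈ (snocRow-cong {sh = l} h (λ _ → ≡.refl))) ⟩
    ∑Box (l ∘ inject₁) (λ μ → ∑Fill N μ (λ T → f (snocRow {sh = l} (extendFill (l ∘ inject₁) μ T) (λ _ → lastF N))))
      ≈⟨ ∑Box-cong≤ (l ∘ inject₁) (λ μ μ≤l → trans (∑Fill-cong N μ (term μ μ≤l)) (trans
           (sym (∑Fill-*ˡ N μ _ _)) (*-assoc _ _ _))) ⟩
    ∑Box (l ∘ inject₁) (λ μ → pow R x (l (lastF N)) * (branchWeight l x μ * ∑SSYT N μ (z ∘ inject₁)))
      ≈⟨ ∑Box-*ˡ (l ∘ inject₁) _ _ ⟨
    pow R x (l (lastF N)) * ∑Box (l ∘ inject₁) (λ μ → branchWeight l x μ * ∑SSYT N μ (z ∘ inject₁)) ∎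
    where
    x : Carrier
    x = z (lastF N)
    f : Fill (suc N) l → Carrier
    f T = ind (columnStrict? l T) (weight l z T)
    f≈ : FillExt f
    f≈ = summand-ext l z
    lastRow : ∀ T (r : Fin (l (lastF N)) → Fin (suc N)) c → r c ≢ lastF N → f (snocRow {sh = l} T r) ≈ 0#
    lastRow T r c r≢ = ind-no (columnStrict? l _) (λ cs → r≢ (last-max (r c)
      (≡.subst₂ ℕ._≤_ (FinP.toℕ-fromℕ N) (≡.cong toℕ (snocRow-last {sh = l} T r c))
        (ColumnStrict-bound l part _ cs (lastF N) c))))
    term : ∀ μ (μ≤l : ∀ i → μ i ℕ.≤ l (inject₁ i)) T → f (completed l part μ μ≤l T) ≈
      (pow R x (l (lastF N)) * branchWeight l x μ) * ind (columnStrict? μ T) (weight μ (z ∘ inject₁) T)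
    term μ μ≤l T with interlaces? l μ
    ... | yes p = begin
      f (completed l part μ μ≤l T)
        ≈⟨ ind-⇔ (columnStrict? l _) (columnStrict? μ T) (ColumnStrict⇒ColumnStrict l part μ μ≤l T)
             (completed-ColumnStrict l part μ μ≤l T p) (trans (weight-completed l part z μ μ≤l T) (sym (*-assoc _ _ _))) ⟩
      ind (columnStrict? μ T) ((pow R x (l (lastF N)) * ∏ (λ a → pow R x (l (inject₁ a) ∸ μ a))) * weight μ (z ∘ inject₁) T)
        ≈⟨ ind-*ˡ (columnStrict? μ T) _ _ ⟨
      (pow R x (l (lastF N)) * ∏ (λ a → pow R x (l (inject₁ a) ∸ μ a))) * ind (columnStrict? μ T) (weight μ (z ∘ inject₁) T)
        ≈⟨ *-congʳ (*-congˡ (branchWeight-yes l x μ p)) ⟨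
      (pow R x (l (lastF N)) * branchWeight l x μ) * ind (columnStrict? μ T) (weight μ (z ∘ inject₁) T) ∎
    ... | no ¬p = trans (ind-no (columnStrict? l _) (λ cs → ¬p (ColumnStrict⇒Interlaces l part μ μ≤l T cs)))
      (sym (trans (*-congʳ (trans (*-congˡ (branchWeight-no l x μ ¬p)) (zeroʳ _))) (zeroˡ _)))

  -- The sign of the order-reversing permutation of N letters.
  ε : ℕ → Carrier
  ε zero    = 1#
  ε (suc N) = sgn R N * ε N

  ∑SSYT-zero : ∀ {N} (l : Fin 0 → ℕ) (z : Row N) → ∑SSYT N l z ≈ 1#
  ∑SSYT-zero {N} l z = empty _
    where
    empty : ∀ (T : Fill N l) → ind (columnStrict? l T) (weight l z T) ≈ 1#
    empty T = trans (ind-yes (columnStrict? l T) (λ ())) (∏-zero _)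

  -- After reversal the first node of `V` is the variable of the largest letter, so both sides
  -- branch over the same μ with the same weights. Induction needs μ descending: interlacing
  -- provides it, and any other μ has weight zero.
  VDet-∑SSYT : ∀ {N} (l : Fin N → ℕ) → Descending l → ∀ z → VDet l (z ∘ opposite) ≈ ε N * ∑SSYT N l z
  VDet-∑SSYT {zero} l desc z = trans (Det-zero _) (sym (trans (*-identityˡ _) (∑SSYT-zero l z)))
  VDet-∑SSYT {suc N} l desc z = begin
    VDet l (z ∘ opposite)
      ≈⟨ VDet-branch l (z ∘ opposite) desc ⟩
    sgn R N * (p * ∑Box (l ∘ inject₁) (λ μ → branchWeight l x μ * VDet μ (z ∘ inject₁ ∘ opposite)))
      ≈⟨ *-congˡ (*-congˡ (∑Box-cong≤ (l ∘ inject₁) step)) ⟩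
    sgn R N * (p * ∑Box (l ∘ inject₁) (λ μ → ε N * (branchWeight l x μ * ∑SSYT N μ (z ∘ inject₁))))
      ≈⟨ *-congˡ (*-congˡ (∑Box-*ˡ (l ∘ inject₁) _ _)) ⟨
    sgn R N * (p * (ε N * ∑Box (l ∘ inject₁) (λ μ → branchWeight l x μ * ∑SSYT N μ (z ∘ inject₁))))
      ≈⟨ solve 4 (λ s p e b → s :* (p :* (e :* b)) := (s :* e) :* (p :* b)) refl _ _ _ _ ⟩
    ε (suc N) * (p * ∑Box (l ∘ inject₁) (λ μ → branchWeight l x μ * ∑SSYT N μ (z ∘ inject₁)))
      ≈⟨ *-congˡ (∑SSYT-branch l (Descending⇒IsPartition l desc) z) ⟨
    ε (suc N) * ∑SSYT (suc N) l z ∎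
    where
    x p : Carrier
    x = z (lastF N)
    p = pow R x (l (lastF N))
    step : ∀ μ → (∀ i → μ i ℕ.≤ l (inject₁ i)) →
           branchWeight l x μ * VDet μ (z ∘ inject₁ ∘ opposite) ≈
           ε N * (branchWeight l x μ * ∑SSYT N μ (z ∘ inject₁))
    step μ μ≤l with interlaces? l μ
    ... | yes q = trans (*-congˡ (VDet-∑SSYT μ (interlaced-Descending l μ q μ≤l) (z ∘ inject₁)))
      (solve 3 (λ a b d → a :* (b :* d) := b :* (a :* d)) refl _ _ _)
    ... | no ¬q = trans (trans (*-congʳ w≈0) (zeroˡ _))
      (sym (trans (*-congˡ (trans (*-congʳ w≈0) (zeroˡ _))) (zeroʳ _)))
      where
      w≈0 : branchWeight l x μ ≈ 0#
      w≈0 = branchWeight-no l x μ ¬q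

  -- Confluent columns

  -- The column of G_λ belonging to y and the 0-based index r, as a sequence in the exponent a:
  -- the r-th Hasse derivative of tᵃ at y. For a < r the binomial coefficient vanishes.
  hasse : Carrier → ℕ → ℕ → Carrier
  hasse y r a = fromℕ R (a choose r) * pow R y (a ∸ r)

  Gmat≈hasse : ∀ {n} (y : Fin n → Carrier) κ (l : Fin (Vec.sum κ) → ℕ) j p →
               Gmat R y κ l j p ≈
               hasse (y (proj₁ (blockIndex R κ p))) (proj₂ (blockIndex R κ p)) (Vec.sum κ ℕ.+ l j ∸ suc (toℕ j))
  Gmat≈hasse y κ l j p with blockIndex R κ p
  ... | q , r with r ℕ.≤? (Vec.sum κ ℕ.+ l j ∸ suc (toℕ j))
  ...   | yes _  = refl
  ...   | no r≰a = sym (trans (*-congʳ (reflexive (≡.cong (fromℕ R) (k>n⇒nCk≡0 (ℕP.≰⇒> r≰a))))) (zeroˡ _))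

  fromℕ-+ : ∀ a b → fromℕ R (a ℕ.+ b) ≈ fromℕ R a + fromℕ R b
  fromℕ-+ zero    b = sym (+-identityˡ _)
  fromℕ-+ (suc a) b = trans (+-congˡ (fromℕ-+ a b)) (sym (+-assoc _ _ _))

  hasse-zero : ∀ y a → hasse y 0 a ≈ 1# * pow R y a
  hasse-zero y a = *-congʳ (trans (reflexive (≡.cong (fromℕ R) (nC0≡1 a))) (+-identityʳ 1#))
    where
    nC0≡1 : ∀ n → n choose 0 ≡ 1
    nC0≡1 n = ≡.trans (nCk≡nC[n∸k] {0} {n} ℕ.z≤n) (nCn≡1 n)

  -- Pascal's rule. The leftover terms cancel because y · y^(a-r-1) = y^(a-r) for r < a, while for a
  -- ≤ r the binomial coefficient is zero.
  Δ-hasse : ∀ y r a → Δ y (hasse y (suc r)) a ≈ hasse y r a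
  Δ-hasse y r a = begin
    fromℕ R (suc a choose suc r) * pow R y (a ∸ r) + (- y) * hasse y (suc r) a
      ≈⟨ +-cong (*-congʳ (trans (reflexive (≡.cong (fromℕ R) (≡.sym (nCk+nC[k+1]≡[n+1]C[k+1] a r)))) (fromℕ-+ (a choose r) _)))
           (trans (sym (-‿distribˡ-* _ _)) (-‿cong absorb)) ⟩
    (fromℕ R (a choose r) + fromℕ R (a choose suc r)) * pow R y (a ∸ r) + - (fromℕ R (a choose suc r) * pow R y (a ∸ r))
      ≈⟨ +-congʳ (distribʳ _ _ _) ⟩
    (hasse y r a + fromℕ R (a choose suc r) * pow R y (a ∸ r)) + - (fromℕ R (a choose suc r) * pow R y (a ∸ r))
      ≈⟨ trans (+-assoc _ _ _) (trans (+-congˡ (-‿inverseʳ _)) (+-identityʳ _)) ⟩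
    hasse y r a ∎
    where
    absorb : y * hasse y (suc r) a ≈ fromℕ R (a choose suc r) * pow R y (a ∸ r)
    absorb with suc r ℕ.≤? a
    ... | yes r<a = trans (solve 3 (λ y b p → y :* (b :* p) := b :* (y :* p)) refl _ _ _)
      (*-congˡ (reflexive (≡.cong (pow R y) (≡.sym (ℕP.+-∸-assoc 1 r<a)))))
    ... | no r≮a = trans (trans (*-congˡ (trans (*-congʳ c≈0) (zeroˡ _))) (zeroʳ y)) (sym (trans (*-congʳ c≈0) (zeroˡ _)))
      where
      c≈0 : fromℕ R (a choose suc r) ≈ 0#
      c≈0 = reflexive (≡.cong (fromℕ R) (k>n⇒nCk≡0 (ℕP.≰⇒> r≮a)))

  newtonCoeff-cong : ∀ {N} {x y : Row N} {φ ψ : ℕ → Carrier} → x ≐ y → (∀ a → φ a ≈ ψ a) →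
                     newtonCoeff x φ ≐ newtonCoeff y ψ
  newtonCoeff-cong e h zero    = h 0
  newtonCoeff-cong e h (suc p) = newtonCoeff-cong (λ i → e (suc i)) (Δ-cong (e zero) h) p

  Δ-0 : ∀ x a → Δ x (λ _ → 0#) a ≈ 0#
  Δ-0 x a = trans (+-identityˡ _) (zeroʳ _)

  Δs-0 : ∀ {N} (x : Row N) a → Δs x (λ _ → 0#) a ≈ 0#
  Δs-0 {zero}  x a = refl
  Δs-0 {suc N} x a = trans (Δs-cong {x = x ∘ suc} (λ _ → refl) (Δ-0 (x zero)) a) (Δs-0 (x ∘ suc) a)

  newtonCoeff-0 : ∀ {N} (x : Row N) p → newtonCoeff x (λ _ → 0#) p ≈ 0#
  newtonCoeff-0 x zero    = refl
  newtonCoeff-0 x (suc p) = trans (newtonCoeff-cong {x = x ∘ suc} (λ _ → refl) (Δ-0 (x zero)) p) (newtonCoeff-0 (x ∘ suc) p)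

  V-cong : ∀ {N} {x y : Row N} → x ≐ y → ∀ a → V x a ≐ V y a
  V-cong {x = x} {y} e a zero = pow-cong a
    where
    pow-cong : ∀ a → pow R (x zero) a ≈ pow R (y zero) a
    pow-cong zero    = refl
    pow-cong (suc a) = *-cong (e zero) (pow-cong a)
  V-cong {x = x} {y} e a (suc p) = go a
    where
    go : ∀ a → H (x zero) (λ b → V (x ∘ suc) b p) a ≈ H (y zero) (λ b → V (y ∘ suc) b p) a
    go zero    = refl
    go (suc a) = +-cong (*-cong (e zero) (go a)) (V-cong (λ i → e (suc i)) a p)

  ∑Fill-empty : ∀ N m {f : Fill N {m} (λ _ → 0) → Carrier} → FillExt f → ∀ T → ∑Fill N (λ _ → 0) f ≈ f T
  ∑Fill-empty N zero    f≈ T = f≈ (λ ())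
  ∑Fill-empty N (suc m) f≈ T = trans (∑Fill-empty N m (FillExt-consRow {sh = λ _ → 0} f≈ _) (λ i → T (suc i)))
    (f≈ (λ { zero () ; (suc i) c → ≡.refl }))

  ∑SSYT-empty : ∀ N m (z : Row N) → ∑SSYT N {m} (λ _ → 0) z ≈ 1#
  ∑SSYT-empty N m z = trans (∑Fill-empty N m (summand-ext (λ _ → 0) z) T)
    (trans (ind-yes (columnStrict? {N} {m} (λ _ → 0) T) (λ i i′ ())) (∏-≈1 (λ i → ∏-zero _)))
    where
    T : Fill N {m} (λ _ → 0)
    T i ()
    ∏-≈1 : ∀ {k} {f : Fin k → Carrier} → (∀ i → f i ≈ 1#) → ∏ f ≈ 1#
    ∏-≈1 {zero}  h = ∏-zero _
    ∏-≈1 {suc k} h = trans (∏-suc _) (trans (*-cong (h zero) (∏-≈1 (h ∘ suc))) (*-identityˡ 1#))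

  repeatVars-suc : ∀ {n} k (κ : Vec ℕ n) (y : Fin (suc n) → Carrier) p →
                   repeatVars R y (suc k Vec.∷ κ) (suc p) ≡ repeatVars R y (k Vec.∷ κ) p
  repeatVars-suc k κ y p with Fin.splitAt k p
  ... | inj₁ _ = ≡.refl
  ... | inj₂ _ = ≡.refl

  -- Triangularity and nonvanishing over an integral domain

  module _ (1≉0 : ¬ (1# ≈ 0#)) (integral : ∀ a b → a * b ≈ 0# → (a ≈ 0#) ⊎ (b ≈ 0#)) where

    *-≉0 : ∀ {a b} → ¬ (a ≈ 0#) → ¬ (b ≈ 0#) → ¬ (a * b ≈ 0#)
    *-≉0 a≉0 b≉0 e with integral _ _ e
    ... | inj₁ a≈0 = a≉0 a≈0
    ... | inj₂ b≈0 = b≉0 b≈0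

    sgn≉0 : ∀ k → ¬ (sgn R k ≈ 0#)
    sgn≉0 zero    e = 1≉0 e
    sgn≉0 (suc k) e = sgn≉0 k (trans (sym (-‿involutive _)) (trans (-‿cong e) -0#≈0#))

    ε≉0 : ∀ N → ¬ (ε N ≈ 0#)
    ε≉0 zero    = 1≉0
    ε≉0 (suc N) = *-≉0 (sgn≉0 N) (ε≉0 N)

    Det-upperTriangular-≉0 : ∀ {n} (M : Rows n n) → (∀ i j → j Fin.< i → M i j ≈ 0#) →
                             (∀ i → ¬ (M i i ≈ 0#)) → ¬ (Det M ≈ 0#)
    Det-upperTriangular-≉0 {zero}  M low diag e = 1≉0 (trans (sym (Det-zero M)) e)
    Det-upperTriangular-≉0 {suc n} M low diag e =
      *-≉0 (diag zero) (Det-upperTriangular-≉0 (λ a b → M (suc a) (suc b))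
        (λ i j h → low (suc i) (suc j) (ℕ.s≤s h)) (diag ∘ suc))
        (trans (sym corner) e)
      where
      corner : Det M ≈ M zero zero * Det (λ a b → M (suc a) (suc b))
      corner = begin
        Det M
          ≈⟨ trans (Det-col0 M) (∑-suc _) ⟩
        1# * (M zero zero * Det (λ a b → M (suc a) (suc b))) + ∑ (λ i → sgn R (suc (toℕ i)) * (M (suc i) zero * Det (λ a b → M (punchIn (suc i) a) (suc b))))
          ≈⟨ +-cong (*-identityˡ _) (∑-≈0 (λ i → trans (*-congˡ (trans (*-congʳ (low (suc i) zero (ℕ.s≤s ℕ.z≤n))) (zeroˡ _))) (zeroʳ _))) ⟩
        M zero zero * Det (λ a b → M (suc a) (suc b)) + 0#
          ≈⟨ +-identityʳ _ ⟩
        M zero zero * Det (λ a b → M (suc a) (suc b)) ∎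

    -- φ is a generalised eigenvector of the shift: (S - y)^r φ is a nonzero multiple of the
    -- geometric sequence y^a, so one more factor S - y kills it.
    Leads : Carrier → ℕ → (ℕ → Carrier) → Set (c ⊔ ℓ)
    Leads y zero    φ = Σ Carrier λ b → ¬ (b ≈ 0#) × (∀ a → φ a ≈ b * pow R y a)
    Leads y (suc r) φ = Leads y r (Δ y φ)

    Leads-resp : ∀ y r {φ ψ : ℕ → Carrier} → (∀ a → φ a ≈ ψ a) → Leads y r φ → Leads y r ψ
    Leads-resp y zero    h (b , b≉0 , e) = b , b≉0 , λ a → trans (sym (h a)) (e a)
    Leads-resp y (suc r) h               = Leads-resp y r (Δ-cong refl h)

    Leads-hasse : ∀ y r → Leads y r (hasse y r)
    Leads-hasse y zero    = 1# , 1≉0 , hasse-zero y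
    Leads-hasse y (suc r) = Leads-resp y r (λ a → sym (Δ-hasse y r a)) (Leads-hasse y r)

    -- S - w commutes with S - y and multiplies the eigenvector y^a by y - w, so r is kept and the
    -- leading coefficient stays nonzero.
    Leads-Δ : ∀ {y w} r {φ} → ¬ (y ≈ w) → Leads y r φ → Leads y r (Δ w φ)
    Leads-Δ {y} {w} zero {φ} y≉w (b , b≉0 , e) = b * (y + - w) , *-≉0 b≉0 y-w≉0 , λ a → begin
      φ (suc a) + (- w) * φ a                          ≈⟨ +-cong (e (suc a)) (*-congˡ (e a)) ⟩
      b * (y * pow R y a) + (- w) * (b * pow R y a)    ≈⟨ solve 4 (λ b y m p → b :* (y :* p) :+ m :* (b :* p) := (b :* (y :+ m)) :* p) refl b y (- w) _ ⟩
      (b * (y + - w)) * pow R y a                      ∎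
      where
      y-w≉0 : ¬ (y + - w ≈ 0#)
      y-w≉0 h = y≉w (begin
        y                ≈⟨ +-identityʳ y ⟨
        y + 0#           ≈⟨ +-congˡ (-‿inverseˡ w) ⟨
        y + (- w + w)    ≈⟨ +-assoc _ _ _ ⟨
        (y + - w) + w    ≈⟨ +-congʳ h ⟩
        0# + w           ≈⟨ +-identityˡ w ⟩
        w                ∎)
    Leads-Δ {y} {w} (suc r) {φ} y≉w h = Leads-resp y r (Δ-comm w y φ) (Leads-Δ r y≉w h)

    Δ-Leads-zero : ∀ y {φ} → Leads y 0 φ → ∀ a → Δ y φ a ≈ 0#
    Δ-Leads-zero y {φ} (b , _ , e) a = begin
      φ (suc a) + (- y) * φ a                          ≈⟨ +-cong (e (suc a)) (*-congˡ (e a)) ⟩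
      b * (y * pow R y a) + (- y) * (b * pow R y a)    ≈⟨ solve 4 (λ b y m p → b :* (y :* p) :+ m :* (b :* p) := (y :+ m) :* (b :* p)) refl b y (- y) _ ⟩
      (y + - y) * (b * pow R y a)                      ≈⟨ trans (*-congʳ (-‿inverseʳ y)) (zeroˡ _) ⟩
      0#                                               ∎

    LeadsAt : ∀ {n} → (Fin n → Carrier) → (κ : Vec ℕ n) → Fin (Vec.sum κ) → (ℕ → Carrier) → Set (c ⊔ ℓ)
    LeadsAt y κ p φ = Leads (y (proj₁ (blockIndex R κ p))) (proj₂ (blockIndex R κ p)) φ

    Distinct : ∀ {n} → (Fin n → Carrier) → Set ℓ
    Distinct y = ∀ i j → i ≢ j → ¬ (y i ≈ y j)

    -- Removing the first node lowers r by one for the columns of its own block, by the definition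
    -- of `Leads`; for the other blocks r is unchanged because the nodes differ.
    LeadsAt-suc : ∀ {n} k (κ : Vec ℕ n) {y : Fin (suc n) → Carrier} → Distinct y → ∀ p {φ} →
                  LeadsAt y (suc k Vec.∷ κ) (suc p) φ → LeadsAt y (k Vec.∷ κ) p (Δ (y zero) φ)
    LeadsAt-suc k κ y≉ p h with Fin.splitAt k p
    ... | inj₁ r  = h
    ... | inj₂ p′ = Leads-Δ (proj₂ (blockIndex R κ p′)) (y≉ _ zero (λ ())) h

    record Triangular {N} (x : Row N) (p : Fin N) (φ : ℕ → Carrier) : Set (c ⊔ ℓ) where
      field
        killed : Killed x φ
        diag   : ¬ (newtonCoeff x φ p ≈ 0#)
        below  : ∀ k → p Fin.< k → newtonCoeff x φ k ≈ 0#

    open Triangular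

    -- One copy of the first node is stripped at a time, and a block is dropped when exhausted. The
    -- size k stands apart from κ so that the recursion can decrease it.
    triangular′ : ∀ {n} k (κ : Vec ℕ n) {y : Fin (suc n) → Carrier} → Distinct y → ∀ p {φ} →
                  LeadsAt y (k Vec.∷ κ) p φ → Triangular (repeatVars R y (k Vec.∷ κ)) p φ
    triangular′ zero (k Vec.∷ κ) y≉ p h =
      triangular′ k κ (λ i j i≢j → y≉ (suc i) (suc j) (i≢j ∘ FinP.suc-injective)) p h
    -- The column has reached its own node with r = 0: it is b · y^a, so its diagonal coefficient is
    -- b and the next difference is zero.
    triangular′ (suc k) κ {y} y≉ zero {φ} h@(b , b≉0 , e) = record
      { killed = λ a → trans (Δs-cong {x = x ∘ suc} (λ _ → refl) (Δ-Leads-zero (y zero) h) a) (Δs-0 (x ∘ suc) a)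
      ; diag   = λ z → b≉0 (trans (sym (trans (e 0) (*-identityʳ b))) z)
      ; below  = λ { (suc q) _ → trans (newtonCoeff-cong {x = x ∘ suc} (λ _ → refl) (Δ-Leads-zero (y zero) h) q)
                                       (newtonCoeff-0 (x ∘ suc) q) }
      }
      where
      x : Row (Vec.sum (suc k Vec.∷ κ))
      x = repeatVars R y (suc k Vec.∷ κ)
    triangular′ (suc k) κ {y} y≉ (suc p) {φ} h = record
      { killed = λ a → trans (Δs-cong {φ = Δ (y zero) φ} x∘suc (λ _ → refl) a) (killed ih a)
      ; diag   = λ z → diag ih (trans (sym (coeff p)) z)
      ; below  = λ { (suc q) p<q → trans (coeff q) (below ih q (ℕP.≤-pred p<q)) }
      }
      where
      x∘suc : (λ i → repeatVars R y (suc k Vec.∷ κ) (suc i)) ≐ repeatVars R y (k Vec.∷ κ)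
      x∘suc i = reflexive (repeatVars-suc k κ y i)
      coeff : newtonCoeff (λ i → repeatVars R y (suc k Vec.∷ κ) (suc i)) (Δ (y zero) φ) ≐
              newtonCoeff (repeatVars R y (k Vec.∷ κ)) (Δ (y zero) φ)
      coeff = newtonCoeff-cong x∘suc (λ _ → refl)
      ih : Triangular (repeatVars R y (k Vec.∷ κ)) p (Δ (y zero) φ)
      ih = triangular′ k κ y≉ p (LeadsAt-suc k κ y≉ p h)

    triangular : ∀ {n} (κ : Vec ℕ n) {y : Fin n → Carrier} → Distinct y → ∀ p {φ} →
                 LeadsAt y κ p φ → Triangular (repeatVars R y κ) p φ
    triangular (k Vec.∷ κ) = triangular′ k κ

    module _ {n} (κ : Vec ℕ n) {y : Fin n → Carrier} (y≉ : Distinct y) where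
      private
        N : ℕ
        N = Vec.sum κ
        x : Row N
        x = repeatVars R y κ
        col : Fin N → ℕ → Carrier
        col p = hasse (y (proj₁ (blockIndex R κ p))) (proj₂ (blockIndex R κ p))

        col-triangular : ∀ p → Triangular x p (col p)
        col-triangular p = triangular κ y≉ p (Leads-hasse (y (proj₁ (blockIndex R κ p))) (proj₂ (blockIndex R κ p)))

      Gmat-Det : ∀ l → det R (Gmat R y κ l) ≈ Det (λ j p → col p (l j ℕ.+ co j))
      Gmat-Det l = trans (sym (reflexive (Det-def _))) (Det-cong (λ j p → trans (Gmat≈hasse y κ l j p)
        (reflexive (≡.cong (col p) (≡.trans (≡.cong (_∸ suc (toℕ j)) (ℕP.+-comm N (l j)))
          (ℕP.+-∸-assoc (l j) (FinP.toℕ<n j)))))))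

      -- The λ-independent factor for the reversed nodes; up to the sign `ε N` it turns out to be
      -- the confluent Vandermonde determinant.
      quotient : Carrier
      quotient = Det (λ k p → newtonCoeff (x ∘ opposite) (col p) k)

      Gmat-schur : ∀ l → IsPartition N l → det R (Gmat R y κ l) ≈ schur R N l x * (ε N * quotient)
      Gmat-schur l part = begin
        det R (Gmat R y κ l)
          ≈⟨ Gmat-Det l ⟩
        Det (λ j p → col p (l j ℕ.+ co j))
          -- The recurrence is known for the given order and is carried over to the reversed one.
          ≈⟨ Det-Killed (x ∘ opposite) col
               (λ p a → trans (Δs-opposite x (col p) a) (killed (col-triangular p) a)) (λ j → l j ℕ.+ co j) ⟩
        VDet l (x ∘ opposite) * quotient
          ≈⟨ *-congʳ (VDet-∑SSYT l (IsPartition⇒Descending l part) x) ⟩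
        (ε N * ∑SSYT N l x) * quotient
          ≈⟨ solve 3 (λ e s q → (e :* s) :* q := s :* (e :* q)) refl _ _ _ ⟩
        ∑SSYT N l x * (ε N * quotient)
          ≈⟨ *-congʳ (schur≈∑SSYT N l x) ⟨
        schur R N l x * (ε N * quotient) ∎

      Gmat-empty : det R (Gmat R y κ (λ _ → 0)) ≈ ε N * quotient
      Gmat-empty = trans (Gmat-schur (λ _ → 0) (λ _ _ _ → ℕ.z≤n)) (trans
        (*-congʳ (trans (schur≈∑SSYT N (λ _ → 0) x) (∑SSYT-empty N N x))) (*-identityˡ _))

      Gmat-empty-≉0 : ¬ (det R (Gmat R y κ (λ _ → 0)) ≈ 0#)
      -- The interpolation is repeated with the nodes in the given order, where the Newton
      -- coefficients form an upper triangular matrix.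
      Gmat-empty-≉0 e = *-≉0 VDet≉0
        (Det-upperTriangular-≉0 (λ k p → newtonCoeff x (col p) k)
          (λ k p p<k → below (col-triangular p) k p<k) (λ p → diag (col-triangular p)))
        (trans (sym (trans (Gmat-Det (λ _ → 0)) (Det-Killed x col (λ p → killed (col-triangular p)) co))) e)
        where
        -- The given order is the reversal of the reversed list, so the tableau evaluation applies
        -- with the variables `x ∘ opposite`. The empty shape sums to 1 there too, which leaves the
        -- sign `ε N`.
        VDet≉0 : ¬ (Det (λ j → V x (co j)) ≈ 0#)
        VDet≉0 z = ε≉0 N (begin
          ε N
            ≈⟨ *-identityʳ _ ⟨
          ε N * 1#
            ≈⟨ *-congˡ (∑SSYT-empty N N (x ∘ opposite)) ⟨
          ε N * ∑SSYT N {N} (λ _ → 0) (x ∘ opposite)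
            ≈⟨ VDet-∑SSYT {N} (λ _ → 0) (IsPartition⇒Descending {N} (λ _ → 0) (λ _ _ _ → ℕ.z≤n)) (x ∘ opposite) ⟨
          VDet (λ _ → 0) (x ∘ opposite ∘ opposite)
            ≈⟨ Det-cong {N} (λ j → V-cong (λ i → reflexive (≡.cong x (FinP.opposite-involutive i))) (co j)) ⟩
          Det (λ j → V x (co j))
            ≈⟨ z ⟩
          0# ∎)

theorem1p1 : {c ℓ : Level} (R : CommutativeRing c ℓ) →
    let open CommutativeRing R in
    ¬ (1# ≈ 0#) →
    (∀ (a b : Carrier) → a * b ≈ 0# → (a ≈ 0#) ⊎ (b ≈ 0#)) →
    (n : ℕ) (κ : Vec ℕ n) (lam : Fin (Vec.sum κ) → ℕ) →
    IsPartition (Vec.sum κ) lam →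
    (y : Fin n → Carrier) →
    (∀ (i j : Fin n) → i ≢ j → ¬ (y i ≈ y j)) →
    ¬ (det R (Gmat R y κ (λ _ → 0)) ≈ 0#)
    × (schur R (Vec.sum κ) lam (repeatVars R y κ) * det R (Gmat R y κ (λ _ → 0))
       ≈ det R (Gmat R y κ lam))
theorem1p1 R 1≉0 integral n κ lam part y y≉ =
  Gmat-empty-≉0 R 1≉0 integral κ y≉
  , trans (*-congˡ (Gmat-empty R 1≉0 integral κ y≉)) (sym (Gmat-schur R 1≉0 integral κ y≉ lam part))
  where open CommutativeRing R using (trans; sym; *-congˡ)
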